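{- Let $\alpha$ be a composition of $n\ge 1$ and let $S$ be the antipode of the Hopf algebra $\mathfrak{M}\mathrm{NSym}$. Then $$S(\tilde R_\alpha)=(-1)^n\sum_{\beta} M_{\omega(\alpha),\beta}\,\tilde R_\beta,$$ where the sum is over all compositions $\beta$ (only finitely many terms are nonzero).
   Context: A composition is a finite sequence $\alpha=(\alpha_1,\dots,\alpha_k)$ of positive integers; $|\alpha|=\sum\alpha_i$, and $\emptyset$ is the empty composition. For a composition $\alpha$ of $n$ put $S_\alpha=\{\alpha_1,\alpha_1+\alpha_2,\dots,\alpha_1+\dots+\alpha_{k-1}\}\subseteq[n-1]$; conversely for $D=\{s_1<\dots<s_j\}\subseteq[n-1]$ put $\mathcal{C}(D)=(s_1,s_2-s_1,\dots,n-s_j)$. For a word $u=u_1\cdots u_m$ with no two consecutive letters equal, $\mathrm{Des}(u)=\{i\in[m-1]:u_i>u_{i+1}\}$ and $\mathcal{C}(u)=\mathcal{C}(\mathrm{Des}(u))$, a composition of $m$. $w_\alpha$ denotes any permutation of $[n]$ with $\mathcal{C}(w_\alpha)=\alpha$ ($w_\emptyset$ is the empty word). For a permutation $w$ and integer $n$, $w[n]$ is the word obtained by adding $n$ to each letter. Multiwords and multishuffles: $w_1\cdots w_r$ is a multiword of $a_1\cdots a_k$ if there is a nondecreasing surjection $t:[r]\to[k]$ with $w_j=a_{t(j)}$. If $a,b$ are words whose letter sets are disjoint, a multishuffle of $a$ and $b$ is a word $u$ with no two consecutive letters equal such that the subword of $u$ formed by the letters of $a$ is a multiword of $a$ and the subword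 formed by the letters of $b$ is a multiword of $b$. $\mathfrak{M}\mathrm{NSym}$ is the free $\mathbb{Z}$-module with basis $\{\tilde R_\alpha\}$ indexed by all compositions, with unit $\tilde R_\emptyset=1$, counit $\epsilon(\tilde R_\alpha)=0$ for $\alpha\neq\emptyset$, product (for nonempty $\alpha=(\alpha_1,\dots,\alpha_k)$, $\beta=(\beta_1,\dots,\beta_m)$) $\tilde R_\alpha\tilde R_\beta=\tilde R_{(\alpha_1,\dots,\alpha_k,\beta_1,\dots,\beta_m)}+\tilde R_{(\alpha_1,\dots,\alpha_{k-1},\alpha_k+\beta_1-1,\beta_2,\dots,\beta_m)}+\tilde R_{(\alpha_1,\dots,\alpha_{k-1},\alpha_k+\beta_1,\beta_2,\dots,\beta_m)}$, and coproduct $\Delta(\tilde R_\alpha)=\sum_{\beta,\delta}c^\alpha_{\beta,\delta}\tilde R_\beta\otimes\tilde R_\delta$, where $c^\alpha_{\beta,\delta}$ is the number of multishuffles $u$ of $w_\beta$ and $w_\delta[|\beta|]$ with $\mathcal{C}(u)=\alpha$. This is a Hopf algebra; its antipode $S$ is the linear map with $\sum S(a_1)a_2=\epsilon(a)1=\sum a_1S(a_2)$ where $\Delta(a)=\sum a_1\otimes a_2$. $\omega(\alpha)$: for $\alpha$ a composition of $n$, let $\mathrm{rev}(\alpha)=(\alpha_k,\dots,\alpha_1)$; $\omega(\alpha)$ is the composition of $n$ with $S_{\omega(\alpha)}=[n-1]\setminus S_{\mathrm{rev}(\alpha)}$ (the ribbon diagram of $\omega(\alpha)$ is the transpose of that of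 $\alpha$). Mergings: for a nonempty composition $\alpha$ of $n$, its ribbon diagram has rows of lengths $\alpha_1,\dots,\alpha_k$ from bottom to top, the first box of each row directly above the last box of the row below. Listing the boxes from bottom-left to top-right, encode it by the word $a(\alpha)=h^{\alpha_1-1}vh^{\alpha_2-1}v\cdots vh^{\alpha_k-1}\in\{h,v\}^{n-1}$ ($h$: next box to the right, $v$: next box directly above); every word in $\{h,v\}^{m-1}$ is $a(\beta)$ for a unique composition $\beta$ of $m$. $M_{\alpha,\beta}$ is the number of subsets $X\subseteq[n-1]$ such that deleting from $a(\alpha)$ the letters in positions $X$ gives $a(\beta)$; equivalently the number of ways of obtaining the ribbon shape $\beta$ from the ribbon shape $\alpha$ by merging pairs of edge-adjacent boxes (only the set of merged adjacencies matters). In particular $M_{\alpha,\beta}=0$ if $|\beta|>|\alpha|$. -}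

module Defs where

open import Data.Bool using (Bool; T?; true; false; _∧_; _∨_; not; if_then_else_)
open import Data.Nat using (ℕ; zero; suc; _+_; _∸_; _<_; _≡ᵇ_; _<ᵇ_)
open import Data.Integer as ℤ using (ℤ; +_; -_)
open import Data.List using (List; []; _∷_; _++_; map; filter; length; upTo;
  concatMap; replicate; reverse)
open import Data.Nat.ListAction using (sum)
open import Data.Bool.ListAction using (any; all)
open import Data.List.Relation.Unary.All using (All)
open import Data.List.Relation.Binary.Permutation.Propositional using (_↭_)
open import Data.Product using (_×_; _,_; proj₁; proj₂)
open import Relation.Binary.PropositionalEquality using (_≡_)

Composition : Set
Composition = List ℕ

IsComposition : Composition → Set
IsComposition α = All (λ x → 0 < x) α

size : Composition → ℕ
size = sum

eqℕs : List ℕ → List ℕ → Bool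
eqℕs []       []       = true
eqℕs (x ∷ xs) (y ∷ ys) = (x ≡ᵇ y) ∧ eqℕs xs ys
eqℕs _        _        = false

elem : ℕ → List ℕ → Bool
elem x ys = any (λ y → x ≡ᵇ y) ys

count : {A : Set} → (A → Bool) → List A → ℕ
count p xs = length (filter (λ x → T? (p x)) xs)

bools : ℕ → List (List Bool)
bools zero    = [] ∷ []
bools (suc m) = concatMap (λ bs → (false ∷ bs) ∷ (true ∷ bs) ∷ []) (bools m)

words : ℕ → ℕ → List (List ℕ)
words zero    N = [] ∷ []
words (suc L) N = concatMap (λ x → map (x ∷_) (words L N)) (map suc (upTo N))

partialSumsFrom : ℕ → Composition → List ℕ
partialSumsFrom p []           = []
partialSumsFrom p (x ∷ [])     = []
partialSumsFrom p (x ∷ y ∷ r)  = (p + x) ∷ partialSumsFrom (p + x) (y ∷ r)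

descentSet : Composition → List ℕ
descentSet = partialSumsFrom 0

-- C(D) = (s₁, s₂ - s₁, …, n - s_j) for D = {s₁ < ⋯ < s_j} ⊆ [n-1]
-- (given as an increasing list); C of the empty word is ∅.
diffs : ℕ → List ℕ → ℕ → List ℕ
diffs p []      n = (n ∸ p) ∷ []
diffs p (s ∷ D) n = (s ∸ p) ∷ diffs s D n

compOfSet : ℕ → List ℕ → Composition
compOfSet zero    D = []
compOfSet (suc n) D = diffs 0 D (suc n)

desFrom : ℕ → List ℕ → List ℕ
desFrom i (x ∷ y ∷ r) = (if y <ᵇ x then i ∷ [] else []) ++ desFrom (suc i) (y ∷ r)
desFrom i _           = []

Des : List ℕ → List ℕ
Des = desFrom 1

compOfWord : List ℕ → Composition
compOfWord u = compOfSet (length u) (Des u)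

-- w is a multiword of a: w_j = a_{t(j)} for a nondecreasing surjection t : [r] → [k]
isMultiword : List ℕ → List ℕ → Bool
isMultiword []      []      = true
isMultiword (x ∷ w) (y ∷ a) = (x ≡ᵇ y) ∧ (isMultiword w (y ∷ a) ∨ isMultiword w a)
isMultiword _       _       = false

noAdjEq : List ℕ → Bool
noAdjEq (x ∷ y ∷ r) = not (x ≡ᵇ y) ∧ noAdjEq (y ∷ r)
noAdjEq _           = true

subwordOf : List ℕ → List ℕ → List ℕ
subwordOf a u = filter (λ x → T? (elem x a)) u

isMultishuffle : List ℕ → List ℕ → List ℕ → Bool
isMultishuffle a b u =
  noAdjEq u ∧ all (λ x → elem x a ∨ elem x b) u
  ∧ isMultiword (subwordOf a u) a ∧ isMultiword (subwordOf b u) b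

shift : ℕ → List ℕ → List ℕ
shift n = map (_+ n)

bitsToComp : List Bool → ℕ → Composition
bitsToComp []           c = c ∷ []
bitsToComp (true ∷ bs)  c = c ∷ bitsToComp bs 1
bitsToComp (false ∷ bs) c = bitsToComp bs (suc c)

compsOf : ℕ → List Composition
compsOf zero    = [] ∷ []
compsOf (suc m) = map (λ bs → bitsToComp bs 1) (bools m)

compsUpTo : ℕ → List Composition
compsUpTo m = concatMap compsOf (upTo (suc m))

-- Elements of MNSym: finite ℤ-linear combinations of the basis R̃_α

LC : Set
LC = List (ℤ × Composition)

ValidLC : LC → Set
ValidLC x = All (λ t → IsComposition (proj₂ t)) x

coeff : LC → Composition → ℤ
coeff []            γ = + 0
coeff ((a , β) ∷ x) γ = (if eqℕs β γ then a else + 0) ℤ.+ coeff x γ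

_≈_ : LC → LC → Set
x ≈ y = ∀ γ → coeff x γ ≡ coeff y γ

basis : Composition → LC
basis α = (+ 1 , α) ∷ []

scale : ℤ → LC → LC
scale c = map (λ t → (c ℤ.* proj₁ t , proj₂ t))

initLast : ℕ → List ℕ → List ℕ × ℕ
initLast x []      = [] , x
initLast x (y ∷ r) with initLast y r
... | (i , l) = (x ∷ i) , l

mulBasis : Composition → Composition → LC
mulBasis []      β       = basis β
mulBasis (x ∷ α) []      = basis (x ∷ α)
mulBasis (x ∷ α) (b ∷ β) with initLast x α
... | (i , l) = basis (i ++ l ∷ b ∷ β)
              ++ basis (i ++ ((l + b) ∸ 1) ∷ β)
              ++ basis (i ++ (l + b) ∷ β)

mul : LC → LC → LC
mul x y = concatMap (λ s → concatMap (λ t →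
            scale (proj₁ s ℤ.* proj₁ t) (mulBasis (proj₂ s) (proj₂ t))) y) x

epsUnit : Composition → LC
epsUnit []      = basis []
epsUnit (_ ∷ _) = []

IsPermChoice : (Composition → List ℕ) → Set
IsPermChoice w = ∀ β → IsComposition β →
  (w β ↭ map suc (upTo (size β))) × (compOfWord (w β) ≡ β)

-- c^α_{β,δ}: number of multishuffles u of w_β and w_δ[|β|] with C(u) = α.
-- (Such u have length |α| and letters in [|β|+|δ|].)
coprodCoeff : (Composition → List ℕ) → Composition → Composition → Composition → ℕ
coprodCoeff w α β δ =
  count (λ u → isMultishuffle (w β) (shift (size β) (w δ)) u ∧ eqℕs (compOfWord u) α)
        (words (size α) (size β + size δ))

-- Δ(R̃_α) = Σ c^α_{β,δ} R̃_β ⊗ R̃_δ as a list of terms (c, β, δ).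
-- Terms with |β| > |α| or |δ| > |α| vanish (multiwords are surjective),
-- so this list exhausts all nonzero terms.
coproduct : (Composition → List ℕ) → Composition → List (ℕ × Composition × Composition)
coproduct w α = concatMap (λ β → map (λ δ → coprodCoeff w α β δ , β , δ)
                  (compsUpTo (size α))) (compsUpTo (size α))

leftConv : (Composition → List ℕ) → (Composition → LC) → Composition → LC
leftConv w S α = concatMap (λ t → scale (+ proj₁ t)
                   (mul (S (proj₁ (proj₂ t))) (basis (proj₂ (proj₂ t))))) (coproduct w α)

rightConv : (Composition → List ℕ) → (Composition → LC) → Composition → LC
rightConv w S α = concatMap (λ t → scale (+ proj₁ t)
                   (mul (basis (proj₁ (proj₂ t))) (S (proj₂ (proj₂ t))))) (coproduct w α)

-- S (given by its values on the basis, extended linearly) is the antipode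
IsAntipode : (Composition → List ℕ) → (Composition → LC) → Set
IsAntipode w S = ∀ α → IsComposition α →
  ValidLC (S α) × (leftConv w S α ≈ epsUnit α) × (rightConv w S α ≈ epsUnit α)

omega : Composition → Composition
omega α = compOfSet n (filter (λ i → T? (not (elem i (descentSet (reverse α)))))
                              (map suc (upTo (n ∸ 1))))
  where
    n = size α

data HV : Set where
  h v : HV

eqHV : HV → HV → Bool
eqHV h h = true
eqHV v v = true
eqHV _ _ = false

eqHVs : List HV → List HV → Bool
eqHVs []       []       = true
eqHVs (x ∷ xs) (y ∷ ys) = eqHV x y ∧ eqHVs xs ys
eqHVs _        _        = false

ribbonWord : Composition → List HV
ribbonWord []          = []
ribbonWord (x ∷ [])    = replicate (x ∸ 1) h
ribbonWord (x ∷ y ∷ r) = replicate (x ∸ 1) h ++ v ∷ ribbonWord (y ∷ r)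

deleteMarked : List Bool → List HV → List HV
deleteMarked (true ∷ X)  (_ ∷ a) = deleteMarked X a
deleteMarked (false ∷ X) (c ∷ a) = c ∷ deleteMarked X a
deleteMarked _           a       = a

mergings : Composition → Composition → ℕ
mergings []      _       = 0
mergings (_ ∷ _) []      = 0
mergings α       (b ∷ β) =
  count (λ X → eqHVs (deleteMarked X (ribbonWord α)) (ribbonWord (b ∷ β)))
        (bools (size α ∸ 1))

{-# OPTIONS --safe #-}
module Submission where

-- Encode a composition of n ≥ 1 by its ribbon word in {h,v}* (h = false, v = true), and ∅ by nothing.
-- In the free algebra ℤ⟨h,v⟩ the product of MNSym is x ⋆ y = x (h + v + 1) y, and the claimed antipode
-- is S̃ = − φ, where φ is the anti-automorphism h ↦ − (v + 1), v ↦ − (h + 1).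
--
-- A multishuffle u amounts to labelling each letter of u by the word (A or B) it comes from, the step
-- A→B being an ascent h and B→A a descent v; consecutive A-runs are joined by a new letter h or v or
-- by repeating a letter, i.e. multiplied in MNSym. Hence
--   Δ R_a = Σ (product of the A-runs) ⊗ (product of the B-runs)  over the admissible labellings of a.
-- In Σ R′ ⋆ S̃(R″) the first box of a acts on the outer ends only. Induction on a shows that the
-- labellings starting with A contribute (− (v + 1))^#h v^#v, and those starting with B its negative;
-- the induction closes because this polynomial commutes with v.
--
-- Since Δ R_α contains ∅ ⊗ R_α and otherwise only R_β ⊗ R_δ with |δ| < |α|, the equation
-- id ⋆ S = ε determines S by induction on |α|.

open import Defs
open import Data.Bool using (Bool; true; false; not; _∧_; _∨_; if_then_else_; T; T?)
open import Data.Bool.ListAction using (all)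
open import Data.Bool.Properties using (not-involutive)
open import Data.Empty using (⊥-elim)
open import Data.Integer using (ℤ; +_; -_; _*_; _^_; _+_)
import Data.Integer.Properties as ℤ
open import Data.Integer.Tactic.RingSolver using (solve-∀)
open import Data.List using (List; []; _∷_; _++_; _∷ʳ_; applyUpTo; concatMap; filter; length; map;
  replicate; reverse; upTo)
open import Data.List.Membership.Propositional using (_∈_)
open import Data.List.Membership.Propositional.Properties using (∈-map⁺; ∈-map⁻; ∈-upTo⁺; ∈-upTo⁻)
open import Data.List.Properties using (++-assoc; ++-identityʳ; length-map; length-reverse; map-upTo;
  reverse-map; unfold-reverse)
open import Data.List.Relation.Binary.Permutation.Propositional using (_↭_; ↭-sym; ↭⇒↭ₛ)
open import Data.List.Relation.Binary.Permutation.Propositional.Properties using (∈-resp-↭; ↭-empty-inv)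
import Data.List.Relation.Binary.Permutation.Setoid.Properties as Permutation
open import Data.List.Relation.Unary.All as All using (All; []; _∷_)
open import Data.List.Relation.Unary.All.Properties using (map⁺)
open import Data.List.Relation.Unary.AllPairs using ([]; _∷_)
open import Data.List.Relation.Unary.Any using (here; there)
open import Data.List.Relation.Unary.Unique.Propositional using (Unique)
import Data.List.Relation.Unary.Unique.Propositional.Properties as Unique
open import Data.Maybe using (Maybe; just; nothing)
open import Data.Nat as ℕ using (ℕ; zero; suc; _≤_; _<_; z≤n; s≤s; _∸_; _≡ᵇ_; _<ᵇ_)
import Data.Nat.Properties as ℕ
open import Data.Product using (_×_; _,_; proj₁; proj₂; ∃)
open import Data.Sum using (inj₁; inj₂)
open import Function using (_∘_; case_of_)
open import Relation.Binary.PropositionalEquality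
  using (_≡_; _≢_; refl; sym; trans; cong; cong₂; subst; setoid; module ≡-Reasoning)

open ≡-Reasoning

-- The coproduct as a sum over labellings

⟦_⟧ : Bool → ℤ
⟦ true ⟧  = + 1
⟦ false ⟧ = + 0

∑ : {A : Set} → List A → (A → ℤ) → ℤ
∑ []       f = + 0
∑ (x ∷ xs) f = f x + ∑ xs f

_==_ : Bool → Bool → Bool
true  == c = c
false == c = not c

-- Elements of ℤ⟨h,v⟩ are represented by the functionals f ↦ Σ c_x f(x); here R_(1) R_X.
•× : (List Bool → ℤ) → Maybe (List Bool) → ℤ
•× f nothing  = f []
•× f (just x) = f (false ∷ x) + f (true ∷ x) + f x

-- The part of Δ R_a coming from the labellings that give the first box the label σ (A = false,
-- B = true); the first tensor factor is that of the label σ. A switch of label after a box labelled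
-- σ is possible only at the letter σ, and starts a new run.
Δ₁ : Bool → List Bool → (List Bool → Maybe (List Bool) → ℤ) → ℤ
Δ₁ σ []      F = F [] nothing
Δ₁ σ (c ∷ a) F = Δ₁ σ a (λ x Y → F (c ∷ x) Y)
               + ⟦ c == σ ⟧ * Δ₁ (not σ) a (λ y X → •× (λ x → F x (just y)) X)

•×-cong : ∀ {f g} → (∀ x → f x ≡ g x) → ∀ X → •× f X ≡ •× g X
•×-cong e nothing  = e _
•×-cong e (just x) = cong₂ _+_ (cong₂ _+_ (e _) (e _)) (e _)

•×-+ : ∀ f g X → •× (λ x → f x + g x) X ≡ •× f X + •× g X
•×-+ f g nothing  = refl
•×-+ f g (just x) = lem (f (false ∷ x)) (g (false ∷ x)) (f (true ∷ x)) (g (true ∷ x)) (f x) (g x)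
  where
  lem : ∀ a a′ b b′ c c′ → a + a′ + (b + b′) + (c + c′) ≡ a + b + c + (a′ + b′ + c′)
  lem = solve-∀

•×-* : ∀ k f X → •× (λ x → k * f x) X ≡ k * •× f X
•×-* k f nothing  = refl
•×-* k f (just x) = lem k (f (false ∷ x)) (f (true ∷ x)) (f x)
  where
  lem : ∀ k a b c → k * a + k * b + k * c ≡ k * (a + b + c)
  lem = solve-∀

Δ₁-cong : ∀ σ a {F G} → (∀ x Y → F x Y ≡ G x Y) → Δ₁ σ a F ≡ Δ₁ σ a G
Δ₁-cong σ []      e = e _ _
Δ₁-cong σ (c ∷ a) e = cong₂ _+_ (Δ₁-cong σ a (λ _ _ → e _ _))
  (cong (⟦ c == σ ⟧ *_) (Δ₁-cong (not σ) a (λ _ → •×-cong (λ _ → e _ _))))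

Δ₁-+ : ∀ σ a F G → Δ₁ σ a (λ x Y → F x Y + G x Y) ≡ Δ₁ σ a F + Δ₁ σ a G
Δ₁-+ σ []      F G = refl
Δ₁-+ σ (c ∷ a) F G = trans
  (cong₂ _+_ (Δ₁-+ σ a F₁ G₁) (cong (⟦ c == σ ⟧ *_)
    (trans (Δ₁-cong (not σ) a (λ y → •×-+ (λ x → F x (just y)) (λ x → G x (just y)))) (Δ₁-+ (not σ) a F₂ G₂))))
  (lem ⟦ c == σ ⟧ (Δ₁ σ a F₁) (Δ₁ σ a G₁) (Δ₁ (not σ) a F₂) (Δ₁ (not σ) a G₂))
  where
  F₁ G₁ F₂ G₂ : List Bool → Maybe (List Bool) → ℤ
  F₁ x = F (c ∷ x)
  G₁ x = G (c ∷ x)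
  F₂ y = •× (λ x → F x (just y))
  G₂ y = •× (λ x → G x (just y))
  lem : ∀ k a b c d → a + b + k * (c + d) ≡ a + k * c + (b + k * d)
  lem = solve-∀

Δ₁-* : ∀ σ a k F → Δ₁ σ a (λ x Y → k * F x Y) ≡ k * Δ₁ σ a F
Δ₁-* σ []      k F = refl
Δ₁-* σ (c ∷ a) k F = trans
  (cong₂ _+_ (Δ₁-* σ a k F₁) (cong (⟦ c == σ ⟧ *_)
    (trans (Δ₁-cong (not σ) a (λ y → •×-* k (λ x → F x (just y)))) (Δ₁-* (not σ) a k F₂))))
  (lem ⟦ c == σ ⟧ k (Δ₁ σ a F₁) (Δ₁ (not σ) a F₂))
  where
  F₁ F₂ : List Bool → Maybe (List Bool) → ℤ
  F₁ x = F (c ∷ x)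
  F₂ y = •× (λ x → F x (just y))
  lem : ∀ d k a b → k * a + d * (k * b) ≡ k * (a + d * b)
  lem = solve-∀

Δ₁-0 : ∀ σ a → Δ₁ σ a (λ _ _ → + 0) ≡ + 0
Δ₁-0 σ a = Δ₁-* σ a (+ 0) (λ _ _ → + 0)

Δ₁-∑ : ∀ {A : Set} σ a (L : List A) (F : A → List Bool → Maybe (List Bool) → ℤ) →
  Δ₁ σ a (λ x Y → ∑ L (λ i → F i x Y)) ≡ ∑ L (λ i → Δ₁ σ a (F i))
Δ₁-∑ σ a []      F = Δ₁-0 σ a
Δ₁-∑ σ a (i ∷ L) F = trans (Δ₁-+ σ a (F i) _) (cong (λ t → Δ₁ σ a (F i) + t) (Δ₁-∑ σ a L F))

∣_∣ₘ : Maybe (List Bool) → ℕ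
∣ nothing ∣ₘ = 0
∣ just x ∣ₘ  = suc (length x)

-- A product of ribbons has at most as many boxes as its factors together, so a tensor factor has at
-- most as many boxes as carry its label. The first box carries `σ`, which leaves at most `length a`
-- boxes for the other factor.
Δ₁-cong-bounded : ∀ σ a {F G} →
  (∀ x Y → length x ≤ length a → ∣ Y ∣ₘ ≤ length a → F x Y ≡ G x Y) →
  Δ₁ σ a F ≡ Δ₁ σ a G
Δ₁-cong-bounded σ []      e = e _ _ z≤n z≤n
Δ₁-cong-bounded σ (c ∷ a) e = cong₂ _+_
  (Δ₁-cong-bounded σ a (λ x Y p q → e _ _ (s≤s p) (ℕ.m≤n⇒m≤1+n q)))
  (cong (⟦ c == σ ⟧ *_) (Δ₁-cong-bounded (not σ) a
    λ { y nothing  p q → e _ _ z≤n (s≤s p)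
      ; y (just x) p q → cong₂ _+_ (cong₂ _+_ (e _ _ (ℕ.m≤n⇒m≤1+n q) (s≤s p)) (e _ _ (ℕ.m≤n⇒m≤1+n q) (s≤s p)))
                           (e _ _ (ℕ.≤-trans (ℕ.n≤1+n _) (ℕ.m≤n⇒m≤1+n q)) (s≤s p)) }))

-- The candidate antipode and its products with ribbons

-- S̃ (c y) = S̃ y · φ(c).
S̃ : List Bool → (List Bool → ℤ) → ℤ
S̃ []      k = - k []
S̃ (c ∷ y) k = - (S̃ y (λ z → k (z ∷ʳ not c)) + S̃ y k)

S̃-cong : ∀ y {k l} → (∀ x → k x ≡ l x) → S̃ y k ≡ S̃ y l
S̃-cong []      e = cong -_ (e [])
S̃-cong (c ∷ y) e = cong -_ (cong₂ _+_ (S̃-cong y (λ _ → e _)) (S̃-cong y e))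

S̃-+ : ∀ y k l → S̃ y (λ z → k z + l z) ≡ S̃ y k + S̃ y l
S̃-+ []      k l = ℤ.neg-distrib-+ (k []) (l [])
S̃-+ (c ∷ y) k l = trans (cong -_ (cong₂ _+_ (S̃-+ y k′ l′) (S̃-+ y k l))) (lem (S̃ y k′) (S̃ y l′) (S̃ y k) (S̃ y l))
  where
  k′ l′ : List Bool → ℤ
  k′ z = k (z ∷ʳ not c)
  l′ z = l (z ∷ʳ not c)
  lem : ∀ a b c d → - (a + b + (c + d)) ≡ - (a + c) + - (b + d)
  lem = solve-∀

S̃-•× : ∀ y (K : List Bool → List Bool → ℤ) X →
  S̃ y (λ z → •× (λ x → K x z) X) ≡ •× (λ x → S̃ y (K x)) X
S̃-•× y K nothing  = refl
S̃-•× y K (just x) = trans (S̃-+ y (λ z → K (false ∷ x) z + K (true ∷ x) z) (K x))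
  (cong (_+ S̃ y (K x)) (S̃-+ y (K (false ∷ x)) (K (true ∷ x))))

-- R_x R_z.
join : (List Bool → ℤ) → List Bool → List Bool → ℤ
join k x z = k (x ++ true ∷ z) + k (x ++ z) + k (x ++ false ∷ z)

-- R_X · S̃(R_Y), with the value at (∅, ∅) irrelevant.
RS̃ : (List Bool → ℤ) → Maybe (List Bool) → Maybe (List Bool) → ℤ
RS̃ k nothing  nothing  = k []
RS̃ k (just x) nothing  = k x
RS̃ k nothing  (just y) = S̃ y k
RS̃ k (just x) (just y) = S̃ y (join k x)

-- (− (v + 1))^#h v^#v.
half : List Bool → (List Bool → ℤ) → ℤ
half []          k = k []
half (false ∷ a) k = - (half a (λ z → k (true ∷ z)) + half a k)
half (true ∷ a)  k = half a (λ z → k (true ∷ z))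

half-+ : ∀ a k l → half a (λ z → k z + l z) ≡ half a k + half a l
half-+ []          k l = refl
half-+ (true ∷ a)  k l = half-+ a _ _
half-+ (false ∷ a) k l = trans (cong -_ (cong₂ _+_ (half-+ a k′ l′) (half-+ a k l))) (lem (half a k′) (half a l′) (half a k) (half a l))
  where
  k′ l′ : List Bool → ℤ
  k′ z = k (true ∷ z)
  l′ z = l (true ∷ z)
  lem : ∀ a b c d → - (a + b + (c + d)) ≡ - (a + c) + - (b + d)
  lem = solve-∀

half-commutes : ∀ a k → half a (λ z → k (true ∷ z)) ≡ half a (λ z → k (z ∷ʳ true))
half-commutes []          k = refl
half-commutes (true ∷ a)  k = half-commutes a (λ z → k (true ∷ z))
half-commutes (false ∷ a) k = cong -_ (cong₂ _+_ (half-commutes a (λ z → k (true ∷ z))) (half-commutes a k))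

RS̃-∷ˡ : ∀ c k x Y → RS̃ k (just (c ∷ x)) Y ≡ RS̃ (λ z → k (c ∷ z)) (just x) Y
RS̃-∷ˡ c k x nothing  = refl
RS̃-∷ˡ c k x (just y) = refl

join-∷ʳ : ∀ c k x z → join k x (z ∷ʳ c) ≡ join (λ t → k (t ∷ʳ c)) x z
join-∷ʳ c k x z = sym (cong₂ _+_ (cong₂ _+_ (e _) (e _)) (e _))
  where
  e : ∀ t → k ((x ++ t) ∷ʳ c) ≡ k (x ++ t ∷ʳ c)
  e t = cong k (++-assoc x t (c ∷ []))

-- As `S̃` reverses products, the first letter of the second factor comes out as φ(c) at the right
-- end of the whole product.
RS̃-∷ʳ : ∀ c k X y → RS̃ k X (just (c ∷ y)) ≡
  - (RS̃ (λ z → k (z ∷ʳ not c)) X (just y) + RS̃ k X (just y))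
RS̃-∷ʳ c k nothing  y = refl
RS̃-∷ʳ c k (just x) y = cong (λ t → - (t + S̃ y (join k x))) (S̃-cong y (join-∷ʳ (not c) k x))

-- Associativity: `join k []` is left multiplication by R_(1), that is, by h + v + 1.
RS̃-•ˡ : ∀ k y X → •× (λ x → RS̃ k (just x) (just y)) X ≡ RS̃ (join k []) X (just y)
RS̃-•ˡ k y nothing  = refl
RS̃-•ˡ k y (just x) = trans (sym (S̃-•× y (join k) (just x))) (S̃-cong y (λ z → lem
  (k (false ∷ x ++ true ∷ z)) (k (false ∷ x ++ z)) (k (false ∷ x ++ false ∷ z))
  (k (true ∷ x ++ true ∷ z)) (k (true ∷ x ++ z)) (k (true ∷ x ++ false ∷ z))
  (k (x ++ true ∷ z)) (k (x ++ z)) (k (x ++ false ∷ z))))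
  where
  lem : ∀ a b c d e f g h i → (a + b + c) + (d + e + f) + (g + h + i) ≡
        (d + g + a) + (e + h + b) + (f + i + c)
  lem = solve-∀

-- Right multiplication by R_(1), on functionals.
joinʳ : (List Bool → ℤ) → List Bool → ℤ
joinʳ k z = k (z ∷ʳ true) + k z + k (z ∷ʳ false)

join-joinʳ : ∀ k x z →
  join (joinʳ k) x z ≡ join k x (z ∷ʳ true) + join k x z + join k x (z ∷ʳ false)
join-joinʳ k x z = trans (lem
    (k ((x ++ true ∷ z) ∷ʳ true)) (k (x ++ true ∷ z)) (k ((x ++ true ∷ z) ∷ʳ false))
    (k ((x ++ z) ∷ʳ true)) (k (x ++ z)) (k ((x ++ z) ∷ʳ false))
    (k ((x ++ false ∷ z) ∷ʳ true)) (k (x ++ false ∷ z)) (k ((x ++ false ∷ z) ∷ʳ false)))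
  (cong₂ (λ s t → s + join k x z + t) (sym (join-∷ʳ true k x z)) (sym (join-∷ʳ false k x z)))
  where
  lem : ∀ a b c d e f g h i → (a + b + c) + (d + e + f) + (g + h + i) ≡
        (a + d + g) + (b + e + h) + (c + f + i)
  lem = solve-∀

-- `S̃` reverses products and sends R_(1) to - R_(1), because φ(h + v + 1) = - (v + 1) - (h + 1) + 1
-- = - (h + v + 1).
RS̃-•ʳ : ∀ k x Y → •× (λ y → RS̃ k (just x) (just y)) Y ≡ - RS̃ (joinʳ k) (just x) Y
RS̃-•ʳ k x nothing  = cong (λ t → - (k (x ∷ʳ true) + k t + k (x ∷ʳ false))) (++-identityʳ x)
RS̃-•ʳ k x (just y) = begin
  - (S̃ y Jᵗ + S̃ y J) + - (S̃ y Jᶠ + S̃ y J) + S̃ y J ≡⟨ lem (S̃ y Jᵗ) (S̃ y J) (S̃ y Jᶠ) ⟩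
  - (S̃ y Jᵗ + S̃ y J + S̃ y Jᶠ)
    ≡⟨ cong -_ (trans (S̃-+ y _ Jᶠ) (cong (_+ S̃ y Jᶠ) (S̃-+ y Jᵗ J))) ⟨
  - S̃ y (λ z → Jᵗ z + J z + Jᶠ z)                   ≡⟨ cong -_ (S̃-cong y (join-joinʳ k x)) ⟨
  - S̃ y (join (joinʳ k) x)                          ∎
  where
  J Jᵗ Jᶠ : List Bool → ℤ
  J = join k x
  Jᵗ z = J (z ∷ʳ true)
  Jᶠ z = J (z ∷ʳ false)
  lem : ∀ a b c → - (a + b) + - (c + b) + b ≡ - (a + b + c)
  lem = solve-∀

-- The convolution of the identity with `S̃`

Δ₁-neg : ∀ σ a F → Δ₁ σ a (λ x Y → - F x Y) ≡ - Δ₁ σ a F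
Δ₁-neg σ a F = begin
  Δ₁ σ a (λ x Y → - F x Y)           ≡⟨ Δ₁-cong σ a (λ x Y → ℤ.-1*i≡-i (F x Y)) ⟨
  Δ₁ σ a (λ x Y → - (+ 1) * F x Y)   ≡⟨ Δ₁-* σ a (- (+ 1)) F ⟩
  - (+ 1) * Δ₁ σ a F                 ≡⟨ ℤ.-1*i≡-i _ ⟩
  - Δ₁ σ a F                         ∎

-- Mutual induction on `a`. Let P be the polynomial of the tail. Keeping the label A multiplies P on
-- the left by the first letter, and a switch to B, possible at h, adds - (h + v + 1) P. Keeping B
-- multiplies - P on the right by φ of the first letter, and a switch to A, possible at v, adds - P
-- (h + v + 1).
conv-A : ∀ a k → Δ₁ false a (λ x Y → RS̃ k (just x) Y) ≡ half a k
conv-B : ∀ a k → Δ₁ true a (λ y X → RS̃ k X (just y)) ≡ - half a k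

conv-A []          k = refl
conv-A (false ∷ a) k = begin
  _ ≡⟨ cong₂ (λ s t → s + + 1 * t) (trans (Δ₁-cong false a (RS̃-∷ˡ false k)) (conv-A a (λ z → k (false ∷ z))))
        (trans (Δ₁-cong true a (RS̃-•ˡ k)) (conv-B a (join k []))) ⟩
  half a kᶠ + + 1 * - half a (join k [])
    ≡⟨ cong (λ t → half a kᶠ + + 1 * - t) (trans (half-+ a _ kᶠ) (cong (_+ half a kᶠ) (half-+ a _ k))) ⟩
  -- The term h P cancels: h P - (h + v + 1) P = - (v + 1) P.
  half a kᶠ + + 1 * - (half a (λ z → k (true ∷ z)) + half a k + half a kᶠ) ≡⟨ lem (half a kᶠ) (half a (λ z → k (true ∷ z))) (half a k) ⟩
  - (half a (λ z → k (true ∷ z)) + half a k) ∎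
  where
  kᶠ : List Bool → ℤ
  kᶠ z = k (false ∷ z)
  lem : ∀ a b c → a + + 1 * - (b + c + a) ≡ - (b + c)
  lem = solve-∀
conv-A (true ∷ a)  k = begin
  _ ≡⟨ cong₂ _+_ (trans (Δ₁-cong false a (RS̃-∷ˡ true k)) (conv-A a (λ z → k (true ∷ z))))
         (ℤ.*-zeroˡ (Δ₁ true a (λ y → •× (λ x → RS̃ k (just x) (just y))))) ⟩
  half a (λ z → k (true ∷ z)) + + 0 ≡⟨ ℤ.+-identityʳ _ ⟩
  half a (λ z → k (true ∷ z)) ∎

conv-B []          k = refl
conv-B (c ∷ a)     k = begin
  _ ≡⟨ cong (_+ Z) (trans (Δ₁-cong true a (λ y X → RS̃-∷ʳ c k X y)) (Δ₁-neg true a _)) ⟩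
  - Δ₁ true a (λ y X → RS̃ k′ X (just y) + RS̃ k X (just y)) + Z
    ≡⟨ cong (λ t → - t + Z) (trans (Δ₁-+ true a _ _) (cong₂ _+_ (conv-B a k′) (conv-B a k))) ⟩
  - (- half a k′ + - half a k) + Z ≡⟨ cong (λ s → - (- half a k′ + - half a k) + ⟦ c == true ⟧ * s)
      (trans (Δ₁-cong false a (λ x Y → RS̃-•ʳ k x Y)) (trans (Δ₁-neg false a _) (cong -_ (conv-A a (joinʳ k))))) ⟩
  - (- half a k′ + - half a k) + ⟦ c == true ⟧ * - half a (joinʳ k)
    ≡⟨ cong (λ t → - (- half a k′ + - half a k) + ⟦ c == true ⟧ * - t) (trans (half-+ a _ kᶠ) (cong (_+ half a kᶠ) (half-+ a kᵗ k))) ⟩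
  - (- half a k′ + - half a k) + ⟦ c == true ⟧ * - (half a kᵗ + half a k + half a kᶠ) ≡⟨ final c ⟩
  - half (c ∷ a) k ∎
  where
  k′ kᵗ kᶠ : List Bool → ℤ
  k′ z = k (z ∷ʳ not c)
  kᵗ z = k (z ∷ʳ true)
  kᶠ z = k (z ∷ʳ false)
  Z : ℤ
  Z = ⟦ c == true ⟧ * Δ₁ false a (λ x Y → •× (λ y → RS̃ k (just x) (just y)) Y)
  lem₁ : ∀ b c d → - (- c + - b) + + 1 * - (d + b + c) ≡ - d
  lem₁ = solve-∀
  lem₂ : ∀ b c d → - (- d + - b) + + 0 * - (d + b + c) ≡ - - (d + b)
  lem₂ = solve-∀
  -- At v the sum is P (h + 1) - P (h + v + 1) = - P v; at h there is no switch and it is P (v + 1).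
  -- Then `half-commutes` moves v to the left.
  final : ∀ c → - (- half a (λ z → k (z ∷ʳ not c)) + - half a k) + ⟦ c == true ⟧ * - (half a kᵗ + half a k + half a kᶠ) ≡ - half (c ∷ a) k
  final true  = trans (lem₁ (half a k) (half a kᶠ) (half a kᵗ)) (cong -_ (sym (half-commutes a k)))
  final false = trans (lem₂ (half a k) (half a kᶠ) (half a kᵗ)) (cong (λ t → - - (t + half a k)) (sym (half-commutes a k)))

-- Finite sums and indicators

∑-cong : ∀ {A : Set} (L : List A) {f g : A → ℤ} → (∀ x → f x ≡ g x) → ∑ L f ≡ ∑ L g
∑-cong []      e = refl
∑-cong (x ∷ L) e = cong₂ _+_ (e x) (∑-cong L e)

∑-congAll : ∀ {A : Set} {L : List A} {f g : A → ℤ} → All (λ x → f x ≡ g x) L → ∑ L f ≡ ∑ L g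
∑-congAll []       = refl
∑-congAll (e ∷ es) = cong₂ _+_ e (∑-congAll es)

∑-0 : ∀ {A : Set} (L : List A) → ∑ L (λ _ → + 0) ≡ + 0
∑-0 []      = refl
∑-0 (x ∷ L) = trans (ℤ.+-identityˡ _) (∑-0 L)

∑-+ : ∀ {A : Set} (L : List A) (f g : A → ℤ) → ∑ L (λ x → f x + g x) ≡ ∑ L f + ∑ L g
∑-+ []      f g = refl
∑-+ (x ∷ L) f g = trans (cong (λ t → f x + g x + t) (∑-+ L f g)) (lem (f x) (g x) (∑ L f) (∑ L g))
  where
  lem : ∀ a b c d → a + b + (c + d) ≡ a + c + (b + d)
  lem = solve-∀

∑-*ˡ : ∀ {A : Set} (L : List A) k (f : A → ℤ) → ∑ L (λ x → k * f x) ≡ k * ∑ L f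
∑-*ˡ []      k f = sym (ℤ.*-zeroʳ k)
∑-*ˡ (x ∷ L) k f = trans (cong (λ t → k * f x + t) (∑-*ˡ L k f)) (sym (ℤ.*-distribˡ-+ k (f x) (∑ L f)))

∑-++ : ∀ {A : Set} (L M : List A) f → ∑ (L ++ M) f ≡ ∑ L f + ∑ M f
∑-++ []      M f = sym (ℤ.+-identityˡ _)
∑-++ (x ∷ L) M f = trans (cong (λ t → f x + t) (∑-++ L M f)) (sym (ℤ.+-assoc (f x) (∑ L f) (∑ M f)))

∑-map : ∀ {A B : Set} (g : A → B) (L : List A) f → ∑ (map g L) f ≡ ∑ L (λ x → f (g x))
∑-map g []      f = refl
∑-map g (x ∷ L) f = cong (λ t → f (g x) + t) (∑-map g L f)

∑-concatMap : ∀ {A B : Set} (g : A → List B) (L : List A) f →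
  ∑ (concatMap g L) f ≡ ∑ L (λ x → ∑ (g x) f)
∑-concatMap g []      f = refl
∑-concatMap g (x ∷ L) f = trans (∑-++ (g x) _ f) (cong (λ t → ∑ (g x) f + t) (∑-concatMap g L f))

∑-count : ∀ {A : Set} (p : A → Bool) L → + count p L ≡ ∑ L (λ x → ⟦ p x ⟧)
∑-count p []      = refl
∑-count p (x ∷ L) with p x
... | true  = trans (ℤ.pos-+ 1 _) (cong (λ t → + 1 + t) (∑-count p L))
... | false = trans (∑-count p L) (sym (ℤ.+-identityˡ _))

⟦∧⟧ : ∀ a b → ⟦ a ∧ b ⟧ ≡ ⟦ a ⟧ * ⟦ b ⟧
⟦∧⟧ true  b = sym (ℤ.*-identityˡ _)
⟦∧⟧ false b = sym (ℤ.*-zeroˡ ⟦ b ⟧)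

==-refl : ∀ a → (a == a) ≡ true
==-refl true  = refl
==-refl false = refl

==-not : ∀ a → (not a == a) ≡ false
==-not true  = refl
==-not false = refl

==-comm : ∀ a b → (a == b) ≡ (b == a)
==-comm true  true  = refl
==-comm true  false = refl
==-comm false true  = refl
==-comm false false = refl

≡ᵇ-refl : ∀ x → (x ≡ᵇ x) ≡ true
≡ᵇ-refl zero    = refl
≡ᵇ-refl (suc x) = ≡ᵇ-refl x

≡ᵇ-true : ∀ x y → (x ≡ᵇ y) ≡ true → x ≡ y
≡ᵇ-true x y e = ℕ.≡ᵇ⇒≡ x y (subst T (sym e) _)

≡ᵇ-false : ∀ x y → x ≢ y → (x ≡ᵇ y) ≡ false
≡ᵇ-false x y x≢y with x ≡ᵇ y in e
... | true  = ⊥-elim (x≢y (≡ᵇ-true x y e))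
... | false = refl

<ᵇ-true : ∀ x y → x < y → (x <ᵇ y) ≡ true
<ᵇ-true x y p with x <ᵇ y | ℕ.<⇒<ᵇ p
... | true | _ = refl

<ᵇ-false : ∀ x y → y ≤ x → (x <ᵇ y) ≡ false
<ᵇ-false x y p with x <ᵇ y in e
... | true  = ⊥-elim (ℕ.<⇒≱ (ℕ.<ᵇ⇒< x y (subst T (sym e) _)) p)
... | false = refl

∑-select : ∀ (L : List ℕ) x K → Unique L → x ∈ L → ∑ L (λ z → ⟦ z ≡ᵇ x ⟧ * K) ≡ K
∑-select (y ∷ L) .y K (y∉L ∷ u) (here refl) = begin
  ⟦ y ≡ᵇ y ⟧ * K + ∑ L (λ z → ⟦ z ≡ᵇ y ⟧ * K)
    ≡⟨ cong₂ (λ b t → ⟦ b ⟧ * K + t) (≡ᵇ-refl y) (∑-congAll (all-zero y∉L)) ⟩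
  + 1 * K + ∑ L (λ _ → + 0) ≡⟨ cong₂ _+_ (ℤ.*-identityˡ K) (∑-0 L) ⟩
  K + + 0 ≡⟨ ℤ.+-identityʳ K ⟩
  K ∎
  where
  all-zero : ∀ {L} → All (y ≢_) L → All (λ z → ⟦ z ≡ᵇ y ⟧ * K ≡ + 0) L
  all-zero []       = []
  all-zero (p ∷ ps) = trans (cong (λ b → ⟦ b ⟧ * K) (≡ᵇ-false _ y (p ∘ sym))) (ℤ.*-zeroˡ K) ∷ all-zero ps
∑-select (y ∷ L) x K (y∉L ∷ u) (there x∈L) = begin
  ⟦ y ≡ᵇ x ⟧ * K + ∑ L (λ z → ⟦ z ≡ᵇ x ⟧ * K)
    ≡⟨ cong₂ (λ b t → ⟦ b ⟧ * K + t) (≡ᵇ-false y x (All.lookup y∉L x∈L)) (∑-select L x K u x∈L) ⟩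
  + 0 * K + K ≡⟨ cong (_+ K) (ℤ.*-zeroˡ K) ⟩
  + 0 + K ≡⟨ ℤ.+-identityˡ K ⟩
  K ∎

∑-words : ∀ L N f → ∑ (words (suc L) N) f ≡ ∑ (map suc (upTo N)) (λ z → ∑ (words L N) (λ u → f (z ∷ u)))
∑-words L N f = trans (∑-concatMap (λ x → map (x ∷_) (words L N)) (map suc (upTo N)) f)
  (∑-cong (map suc (upTo N)) (λ z → ∑-map (z ∷_) (words L N) f))

-- Descent words and the recursive count of multishuffles

des : List ℕ → List Bool
des (x ∷ y ∷ u) = (y <ᵇ x) ∷ des (y ∷ u)
des _           = []

desWord : List ℕ → Maybe (List Bool)
desWord []      = nothing
desWord (x ∷ u) = just (des (x ∷ u))

ind : List Bool → List Bool → ℤ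
ind []      []      = + 1
ind (c ∷ x) (d ∷ y) = ⟦ c == d ⟧ * ind x y
ind _       _       = + 0

ind? : Maybe (List Bool) → Maybe (List Bool) → ℤ
ind? nothing  nothing  = + 1
ind? (just x) (just y) = ind x y
ind? _        _        = + 0

-- The functional dual to R_X ⊗ R_Y: the value of `Δ₁` on it is the coefficient of this tensor.
ind² : Maybe (List Bool) → Maybe (List Bool) → List Bool → Maybe (List Bool) → ℤ
ind² X Y x y = ind? X (just x) * ind? Y y

headDes : ℕ → List ℕ → Bool
headDes x []      = false
headDes x (y ∷ _) = y <ᵇ x

-- Indicator that u is a multishuffle of xs and ys with descent word a which starts with the first letter
-- of xs. After that letter, a switch to ys leaves open whether the letter will be repeated later, hence
-- the two terms with x ∷ xs and xs.
shuffleFrom shuffleFrom′ : Bool → List ℕ → List Bool → List ℕ → List ℕ → ℤ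
shuffleFrom σ []      a xs       ys = + 0
shuffleFrom σ (z ∷ u) a []       ys = + 0
shuffleFrom σ (z ∷ u) a (x ∷ xs) ys = ⟦ z ≡ᵇ x ⟧ * shuffleFrom′ σ u a (x ∷ xs) ys
shuffleFrom′ σ u       a       []       ys = + 0
shuffleFrom′ σ u       (c ∷ a) (x ∷ xs) ys = ⟦ headDes x xs == c ⟧ * shuffleFrom σ u a xs ys
  + ⟦ c == σ ⟧ * (shuffleFrom (not σ) u a ys (x ∷ xs) + shuffleFrom (not σ) u a ys xs)
shuffleFrom′ σ []      []      (x ∷ xs) ys = ⟦ isMultiword [] xs ⟧ * ⟦ isMultiword [] ys ⟧
shuffleFrom′ σ (t ∷ u) []      (x ∷ xs) ys = + 0

InRange : ℕ → ℕ → Set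
InRange N x = x ∈ map suc (upTo N)

-- The first letter of `u` is forced, and each further step goes on in the same word or switches,
-- just as in the recursion of `Δ₁`. The two terms after a switch correspond to the factor R_(1) by
-- `•×-ind`.
∑-shuffleFrom : ∀ N σ a xs ys → All (InRange N) xs → All (InRange N) ys →
  ∑ (words (suc (length a)) N) (λ u → shuffleFrom σ u a xs ys) ≡ Δ₁ σ a (ind² (desWord xs) (desWord ys))
∑-shuffleFrom′ : ∀ N σ a x xs ys → All (InRange N) (x ∷ xs) → All (InRange N) ys →
  ∑ (words (length a) N) (λ u → shuffleFrom′ σ u a (x ∷ xs) ys) ≡ Δ₁ σ a (ind² (just (des (x ∷ xs))) (desWord ys))

∑-shuffleFrom N σ a []       ys rx ry = begin
  ∑ (words (suc (length a)) N) (λ u → shuffleFrom σ u a [] ys)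
    ≡⟨ ∑-cong (words (suc (length a)) N) (λ { [] → refl ; (_ ∷ _) → refl }) ⟩
  ∑ (words (suc (length a)) N) (λ _ → + 0) ≡⟨ ∑-0 (words (suc (length a)) N) ⟩
  + 0                                      ≡⟨ Δ₁-0 σ a ⟨
  Δ₁ σ a (λ _ _ → + 0)                     ≡⟨ Δ₁-cong σ a (λ _ Y → ℤ.*-zeroˡ (ind? (desWord ys) Y)) ⟨
  Δ₁ σ a (ind² nothing (desWord ys))              ∎
∑-shuffleFrom N σ a (x ∷ xs) ys (r ∷ rx) ry = begin
  ∑ (words (suc (length a)) N) (λ u → shuffleFrom σ u a (x ∷ xs) ys)
    ≡⟨ ∑-words (length a) N (λ u → shuffleFrom σ u a (x ∷ xs) ys) ⟩
  ∑ (map suc (upTo N)) (λ z → ∑ (words (length a) N) (λ u → ⟦ z ≡ᵇ x ⟧ * shuffleFrom′ σ u a (x ∷ xs) ys))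
    ≡⟨ ∑-cong (map suc (upTo N)) (λ z → ∑-*ˡ (words (length a) N) ⟦ z ≡ᵇ x ⟧ (λ u → shuffleFrom′ σ u a (x ∷ xs) ys)) ⟩
  ∑ (map suc (upTo N)) (λ z → ⟦ z ≡ᵇ x ⟧ * ∑ (words (length a) N) (λ u → shuffleFrom′ σ u a (x ∷ xs) ys))
    ≡⟨ ∑-select (map suc (upTo N)) x _ (Unique.map⁺ ℕ.suc-injective (Unique.upTo⁺ N)) r ⟩
  ∑ (words (length a) N) (λ u → shuffleFrom′ σ u a (x ∷ xs) ys)
    ≡⟨ ∑-shuffleFrom′ N σ a x xs ys (r ∷ rx) ry ⟩
  Δ₁ σ a (ind² (just (des (x ∷ xs))) (desWord ys)) ∎

ind-des : ∀ x xs c w → ind (des (x ∷ xs)) (c ∷ w) ≡ ⟦ headDes x xs == c ⟧ * ind? (desWord xs) (just w)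
ind-des x []       c w = sym (ℤ.*-zeroʳ ⟦ not c ⟧)
ind-des x (y ∷ xs) c w = refl

-- This accounts for the factor R_(1) in `Δ₁`. The ribbon of `x ∷ xs` occurs in R_(1) R_X through
-- the merged term if X is that ribbon itself, so that `x` is repeated after the switch, and through
-- a term that adds a box if X is the ribbon of `xs`, so that `x` is finished.
•×-ind : ∀ x xs m X → •× (λ w → ind (des (x ∷ xs)) w * m) X ≡
  m * ind? (just (des (x ∷ xs))) X + m * ind? (desWord xs) X
•×-ind x []       m nothing  = lem m
  where
  lem : ∀ m → + 1 * m ≡ m * + 0 + m * + 1
  lem = solve-∀
•×-ind x []       m (just w) = lem m (ind [] w)
  where
  lem : ∀ m i → + 0 * m + + 0 * m + i * m ≡ m * i + m * + 0
  lem = solve-∀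
•×-ind x (y ∷ xs) m nothing  = lem m
  where
  lem : ∀ m → + 0 * m ≡ m * + 0 + m * + 0
  lem = solve-∀
•×-ind x (y ∷ xs) m (just w) with y <ᵇ x
... | true  = lem m (ind (des (y ∷ xs)) w) (ind (true ∷ des (y ∷ xs)) w)
  where
  lem : ∀ m i j → + 0 * i * m + + 1 * i * m + j * m ≡ m * j + m * i
  lem = solve-∀
... | false = lem m (ind (des (y ∷ xs)) w) (ind (false ∷ des (y ∷ xs)) w)
  where
  lem : ∀ m i j → + 1 * i * m + + 0 * i * m + j * m ≡ m * j + m * i
  lem = solve-∀

∑-shuffleFrom′ N σ []      x []       []       rx ry = refl
∑-shuffleFrom′ N σ []      x []       (y ∷ ys) rx ry = refl
∑-shuffleFrom′ N σ []      x (_ ∷ xs) []       rx ry = refl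
∑-shuffleFrom′ N σ []      x (_ ∷ xs) (y ∷ ys) rx ry = refl
∑-shuffleFrom′ N σ (c ∷ a) x xs ys (r ∷ rx) ry = begin
  ∑ W (λ u → k * shuffleFrom σ u a xs ys + l * (shuffleFrom (not σ) u a ys (x ∷ xs) + shuffleFrom (not σ) u a ys xs))
    ≡⟨ ∑-+ W _ (λ u → l * (shuffleFrom (not σ) u a ys (x ∷ xs) + shuffleFrom (not σ) u a ys xs)) ⟩
  ∑ W (λ u → k * shuffleFrom σ u a xs ys) + ∑ W (λ u → l * (shuffleFrom (not σ) u a ys (x ∷ xs) + shuffleFrom (not σ) u a ys xs))
    ≡⟨ cong₂ _+_ (∑-*ˡ W k (λ u → shuffleFrom σ u a xs ys))
         (trans (∑-*ˡ W l (λ u → shuffleFrom (not σ) u a ys (x ∷ xs) + shuffleFrom (not σ) u a ys xs))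
           (cong (l *_) (∑-+ W (λ u → shuffleFrom (not σ) u a ys (x ∷ xs)) (λ u → shuffleFrom (not σ) u a ys xs)))) ⟩
  k * ∑ W (λ u → shuffleFrom σ u a xs ys)
    + l * (∑ W (λ u → shuffleFrom (not σ) u a ys (x ∷ xs)) + ∑ W (λ u → shuffleFrom (not σ) u a ys xs))
    ≡⟨ cong₂ (λ s t → k * s + l * t) (∑-shuffleFrom N σ a xs ys rx ry)
         (cong₂ _+_ (∑-shuffleFrom N (not σ) a ys (x ∷ xs) ry (r ∷ rx)) (∑-shuffleFrom N (not σ) a ys xs ry rx)) ⟩
  k * Δ₁ σ a (ind² (desWord xs) (desWord ys))
    + l * (Δ₁ (not σ) a (ind² (desWord ys) (just (des (x ∷ xs)))) + Δ₁ (not σ) a (ind² (desWord ys) (desWord xs)))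
    ≡⟨ cong₂ (λ s t → s + l * t) (sym (Δ₁-* σ a k (ind² (desWord xs) (desWord ys))))
         (sym (Δ₁-+ (not σ) a (ind² (desWord ys) (just (des (x ∷ xs)))) (ind² (desWord ys) (desWord xs)))) ⟩
  Δ₁ σ a (λ w Y → k * ind² (desWord xs) (desWord ys) w Y)
    + l * Δ₁ (not σ) a (λ y X → ind² (desWord ys) (just (des (x ∷ xs))) y X + ind² (desWord ys) (desWord xs) y X)
    ≡⟨ cong₂ (λ s t → s + l * t)
         (Δ₁-cong σ a (λ w Y → trans (sym (ℤ.*-assoc k (ind? (desWord xs) (just w)) (ind? (desWord ys) Y)))
                                  (cong (_* ind? (desWord ys) Y) (sym (ind-des x xs c w)))))
         (Δ₁-cong (not σ) a (λ y X → sym (•×-ind x xs (ind? (desWord ys) (just y)) X))) ⟩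
  Δ₁ σ (c ∷ a) (ind² (just (des (x ∷ xs))) (desWord ys)) ∎
  where
  W : List (List ℕ)
  W = words (suc (length a)) N
  k l : ℤ
  k = ⟦ headDes x xs == c ⟧
  l = ⟦ c == σ ⟧

-- The multishuffle test agrees with the recursion

-- The alternatives exclude each other: a multiword of `x ∷ xs` begins with `x`, while one of `xs`
-- is empty or begins with a different letter.
isMultiword-∨ : ∀ s x xs → All (x ≢_) xs →
  ⟦ isMultiword s (x ∷ xs) ∨ isMultiword s xs ⟧ ≡ ⟦ isMultiword s (x ∷ xs) ⟧ + ⟦ isMultiword s xs ⟧
isMultiword-∨ []      x xs x∉xs = sym (ℤ.+-identityˡ _)
isMultiword-∨ (y ∷ s) x [] x∉xs with (y ≡ᵇ x) ∧ (isMultiword s (x ∷ []) ∨ isMultiword s [])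
... | true  = refl
... | false = refl
isMultiword-∨ (y ∷ s) x (x′ ∷ xs) (x≢x′ ∷ x∉xs) with y ≡ᵇ x in e
... | false = sym (ℤ.+-identityˡ _)
... | true  rewrite ≡ᵇ-false y x′ (λ p → x≢x′ (trans (sym (≡ᵇ-true y x e)) p))
  with isMultiword s (x ∷ x′ ∷ xs) ∨ isMultiword s (x′ ∷ xs)
... | true  = refl
... | false = refl

shuffleFrom-unmatched : ∀ σ z u a xs ys → All (z ≢_) xs → shuffleFrom σ (z ∷ u) a xs ys ≡ + 0
shuffleFrom-unmatched σ z u a []       ys _         = refl
shuffleFrom-unmatched σ z u a (x ∷ xs) ys (z≢x ∷ _) rewrite ≡ᵇ-false z x z≢x = ℤ.*-zeroˡ (shuffleFrom′ σ u a (x ∷ xs) ys)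

module _ (p : ℕ) where

  -- With p = |β|, the letters of w_β are at most `p` and those of the shifted w_δ exceed it, so the
  -- comparison gives the label: `false` for A and `true` for B.
  side : ℕ → Bool
  side z = p <ᵇ z

  side-false : ∀ z → side z ≡ false → z ≤ p
  side-false z e with ℕ.≤-<-connex z p
  ... | inj₁ z≤p = z≤p
  ... | inj₂ p<z with () ← trans (sym e) (<ᵇ-true p z p<z)

  side-true : ∀ z → side z ≡ true → p < z
  side-true z e = ℕ.<ᵇ⇒< p z (subst T (sym e) _)

  -- Letters of A are smaller than letters of B. This is the source of the rule `c == σ` for
  -- switches in `Δ₁`.
  sides-descent : ∀ σ x y → side x ≡ σ → side y ≡ not σ → (y <ᵇ x) ≡ σ
  sides-descent true  x y ex ey = <ᵇ-true y x (ℕ.≤-<-trans (side-false y ey) (side-true x ex))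
  sides-descent false x y ex ey = <ᵇ-false y x (ℕ.≤-trans (side-false x ex) (ℕ.<⇒≤ (side-true y ey)))

  OnSide : Bool → List ℕ → Set
  OnSide σ = All (λ z → side z ≡ σ)

  off-side : ∀ σ z {xs} → side z ≡ not σ → OnSide σ xs → All (z ≢_) xs
  off-side σ z e []       = []
  off-side true  z e (e′ ∷ es) = (λ { refl → case (trans (sym e) e′) of λ () }) ∷ off-side true z e es
  off-side false z e (e′ ∷ es) = (λ { refl → case (trans (sym e) e′) of λ () }) ∷ off-side false z e es

  restrict : Bool → List ℕ → List ℕ
  restrict σ []      = []
  restrict σ (z ∷ u) = if side z == σ then z ∷ restrict σ u else restrict σ u

  restrict-on : ∀ σ z u → side z ≡ σ → restrict σ (z ∷ u) ≡ z ∷ restrict σ u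
  restrict-on σ z u refl rewrite ==-refl (side z) = refl

  restrict-off : ∀ σ z u → side z ≡ not σ → restrict σ (z ∷ u) ≡ restrict σ u
  restrict-off σ z u e rewrite e | ==-not σ = refl

  -- The indicator of a multishuffle of `xs` and `ys` with descent word `a`, where the side of a
  -- letter decides which word it belongs to.
  shuffle : Bool → List ℕ → List Bool → List ℕ → List ℕ → ℤ
  shuffle σ u a xs ys = ⟦ noAdjEq u ⟧ * (⟦ isMultiword (restrict σ u) xs ⟧
    * (⟦ isMultiword (restrict (not σ) u) ys ⟧ * ind (des u) a))

  shuffle-swap : ∀ σ u a xs ys → shuffle σ u a xs ys ≡ shuffle (not σ) u a ys xs
  shuffle-swap σ u a xs ys rewrite not-involutive σ = lem ⟦ noAdjEq u ⟧ ⟦ isMultiword (restrict σ u) xs ⟧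
    ⟦ isMultiword (restrict (not σ) u) ys ⟧ (ind (des u) a)
    where
    lem : ∀ a b c d → a * (b * (c * d)) ≡ a * (c * (b * d))
    lem = solve-∀

  side-cases : ∀ {A : Set} σ z → (side z ≡ σ → A) → (side z ≡ not σ → A) → A
  side-cases true  z f g with side z
  ... | true  = f refl
  ... | false = g refl
  side-cases false z f g with side z
  ... | true  = g refl
  ... | false = f refl

  -- Unless `shuffleFrom` vanishes, `t` is the head of `xs`, so the descent from `x` to `t` in `u`
  -- is the one inside `x ∷ xs`.
  head-descent : ∀ σ x t r a xs ys c →
    ⟦ (t <ᵇ x) == c ⟧ * shuffleFrom σ (t ∷ r) a xs ys ≡ ⟦ headDes x xs == c ⟧ * shuffleFrom σ (t ∷ r) a xs ys
  head-descent σ x t r a []       ys c = trans (ℤ.*-zeroʳ ⟦ (t <ᵇ x) == c ⟧) (sym (ℤ.*-zeroʳ ⟦ false == c ⟧))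
  head-descent σ x t r a (y ∷ xs) ys c with t ≡ᵇ y in e
  ... | true rewrite ≡ᵇ-true t y e = refl
  ... | false rewrite ℤ.*-zeroˡ (shuffleFrom′ σ r a (y ∷ xs) ys) = trans (ℤ.*-zeroʳ ⟦ (t <ᵇ x) == c ⟧) (sym (ℤ.*-zeroʳ ⟦ (y <ᵇ x) == c ⟧))

  -- Induction along the word. After the matched letter `x`, the next letter repeats `x`, goes on
  -- within the same side or changes sides. In each case the terms of `shuffleFrom′` for the other
  -- cases vanish; a change of sides exchanges the two words by `shuffle-swap`.
  shuffle≡shuffleFrom : ∀ σ z u a xs ys → side z ≡ σ → OnSide σ xs → OnSide (not σ) ys → Unique xs → Unique ys →
    shuffle σ (z ∷ u) a xs ys ≡ shuffleFrom σ (z ∷ u) a xs ys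
  shuffle≡shuffleFrom σ z u a [] ys ez ox oy ux uy rewrite restrict-on σ z u ez =
    lem ⟦ noAdjEq (z ∷ u) ⟧ (⟦ isMultiword (restrict (not σ) (z ∷ u)) ys ⟧ * ind (des (z ∷ u)) a)
    where
    lem : ∀ a b → a * (+ 0 * b) ≡ + 0
    lem = solve-∀
  shuffle≡shuffleFrom σ z u a (x ∷ xs) ys ez ox oy ux uy rewrite restrict-on σ z u ez with z ≡ᵇ x in e
  ... | false =
    lem ⟦ noAdjEq (z ∷ u) ⟧ (⟦ isMultiword (restrict (not σ) (z ∷ u)) ys ⟧ * ind (des (z ∷ u)) a) (shuffleFrom′ σ u a (x ∷ xs) ys)
    where
    lem : ∀ a b c → a * (+ 0 * b) ≡ + 0 * c
    lem = solve-∀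
  ... | true rewrite ≡ᵇ-true z x e | restrict-off (not σ) x u (trans ez (sym (not-involutive σ))) =
    trans (matched u a ox ux) (sym (ℤ.*-identityˡ _))
    where
    matched : ∀ u a → OnSide σ (x ∷ xs) → Unique (x ∷ xs) →
      ⟦ noAdjEq (x ∷ u) ⟧ * (⟦ isMultiword (restrict σ u) (x ∷ xs) ∨ isMultiword (restrict σ u) xs ⟧
        * (⟦ isMultiword (restrict (not σ) u) ys ⟧ * ind (des (x ∷ u)) a)) ≡ shuffleFrom′ σ u a (x ∷ xs) ys
    matched []      []      ox ux = lem ⟦ isMultiword [] xs ⟧ ⟦ isMultiword [] ys ⟧
      where
      lem : ∀ a b → + 1 * (a * (b * + 1)) ≡ a * b
      lem = solve-∀
    matched []      (c ∷ a) ox ux = lem ⟦ isMultiword [] xs ⟧ ⟦ isMultiword [] ys ⟧ ⟦ headDes x xs == c ⟧ ⟦ c == σ ⟧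
      where
      lem : ∀ a b c d → + 1 * (a * (b * + 0)) ≡ c * + 0 + d * (+ 0 + + 0)
      lem = solve-∀
    matched (t ∷ r) []      ox ux = lem ⟦ noAdjEq (x ∷ t ∷ r) ⟧
        ⟦ isMultiword (restrict σ (t ∷ r)) (x ∷ xs) ∨ isMultiword (restrict σ (t ∷ r)) xs ⟧ ⟦ isMultiword (restrict (not σ) (t ∷ r)) ys ⟧
      where
      lem : ∀ a b c → a * (b * (c * + 0)) ≡ + 0
      lem = solve-∀
    matched (t ∷ r) (c ∷ a) (ox ∷ oxs) (x∉xs ∷ uxs) = side-cases σ t same other
      where
      k l n m′ d : ℤ
      k = ⟦ headDes x xs == c ⟧
      l = ⟦ c == σ ⟧
      n = ⟦ noAdjEq (t ∷ r) ⟧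
      m′ = ⟦ isMultiword (restrict (not σ) (t ∷ r)) ys ⟧
      d = ind (des (t ∷ r)) a
      m : List ℕ → ℤ
      m as = ⟦ isMultiword (restrict σ (t ∷ r)) as ⟧
      Goal : Set
      Goal = ⟦ noAdjEq (x ∷ t ∷ r) ⟧ * (⟦ isMultiword (restrict σ (t ∷ r)) (x ∷ xs) ∨ isMultiword (restrict σ (t ∷ r)) xs ⟧
        * (m′ * (⟦ (t <ᵇ x) == c ⟧ * d))) ≡
        k * shuffleFrom σ (t ∷ r) a xs ys + l * (shuffleFrom (not σ) (t ∷ r) a ys (x ∷ xs) + shuffleFrom (not σ) (t ∷ r) a ys xs)
      same : side t ≡ σ → Goal
      same et with x ≡ᵇ t in e
      -- Equal neighbours are excluded on the left; on the right, `x` occurs neither in `xs` nor on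
      -- the other side.
      ... | true
        rewrite shuffleFrom-unmatched σ t r a xs ys (subst (λ y → All (y ≢_) xs) (≡ᵇ-true x t e) x∉xs)
              | shuffleFrom-unmatched (not σ) t r a ys (x ∷ xs) (off-side (not σ) t (trans et (sym (not-involutive σ))) oy)
              | shuffleFrom-unmatched (not σ) t r a ys xs (off-side (not σ) t (trans et (sym (not-involutive σ))) oy) =
          lem k l (⟦ isMultiword (restrict σ (t ∷ r)) (x ∷ xs) ∨ isMultiword (restrict σ (t ∷ r)) xs ⟧ * (m′ * (⟦ (t <ᵇ x) == c ⟧ * d)))
        where
        lem : ∀ k l z → + 0 * z ≡ k * + 0 + l * (+ 0 + + 0)
        lem = solve-∀
      -- A different letter on the same side means that `x` is finished, so only the first term
      -- survives.
      ... | false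
        rewrite shuffleFrom-unmatched (not σ) t r a ys (x ∷ xs) (off-side (not σ) t (trans et (sym (not-involutive σ))) oy)
              | shuffleFrom-unmatched (not σ) t r a ys xs (off-side (not σ) t (trans et (sym (not-involutive σ))) oy) = begin
          n * (⟦ isMultiword (restrict σ (t ∷ r)) (x ∷ xs) ∨ isMultiword (restrict σ (t ∷ r)) xs ⟧ * (m′ * (⟦ (t <ᵇ x) == c ⟧ * d)))
            ≡⟨ cong (λ b → n * (⟦ b ∨ isMultiword (restrict σ (t ∷ r)) xs ⟧ * (m′ * (⟦ (t <ᵇ x) == c ⟧ * d)))) no-repeat ⟩
          n * (m xs * (m′ * (⟦ (t <ᵇ x) == c ⟧ * d)))          ≡⟨ lem₁ n (m xs) m′ ⟦ (t <ᵇ x) == c ⟧ d ⟩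
          ⟦ (t <ᵇ x) == c ⟧ * (n * (m xs * (m′ * d)))
            ≡⟨ cong (⟦ (t <ᵇ x) == c ⟧ *_) (shuffle≡shuffleFrom σ t r a xs ys et oxs oy uxs uy) ⟩
          ⟦ (t <ᵇ x) == c ⟧ * shuffleFrom σ (t ∷ r) a xs ys              ≡⟨ head-descent σ x t r a xs ys c ⟩
          k * shuffleFrom σ (t ∷ r) a xs ys                              ≡⟨ lem₂ (k * shuffleFrom σ (t ∷ r) a xs ys) l ⟩
          k * shuffleFrom σ (t ∷ r) a xs ys + l * (+ 0 + + 0)            ∎
        where
        lem₁ : ∀ n m m′ k d → n * (m * (m′ * (k * d))) ≡ k * (n * (m * (m′ * d)))
        lem₁ = solve-∀
        lem₂ : ∀ k l → k ≡ k + l * (+ 0 + + 0)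
        lem₂ = solve-∀
        no-repeat : isMultiword (restrict σ (t ∷ r)) (x ∷ xs) ≡ false
        no-repeat rewrite restrict-on σ t r et | ≡ᵇ-false t x 
          (λ p → case trans (sym e) (trans (cong (x ≡ᵇ_) p) (≡ᵇ-refl x)) of λ ()) = refl
      -- The change of sides forces the descent bit to be `σ`. Whether `x` will return is open, and
      -- `isMultiword-∨` splits the test into these two cases.
      other : side t ≡ not σ → Goal
      other et
        rewrite ≡ᵇ-false x t (λ p → All.lookup (off-side σ t et (ox ∷ [])) (here refl) (sym p))
              | shuffleFrom-unmatched σ t r a xs ys (off-side σ t et oxs)
              | sides-descent σ x t ox et
              | ==-comm σ c = begin
          n * (⟦ isMultiword (restrict σ (t ∷ r)) (x ∷ xs) ∨ isMultiword (restrict σ (t ∷ r)) xs ⟧ * (m′ * (l * d)))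
            ≡⟨ cong (λ s → n * (s * (m′ * (l * d)))) (isMultiword-∨ (restrict σ (t ∷ r)) x xs x∉xs) ⟩
          n * ((m (x ∷ xs) + m xs) * (m′ * (l * d)))   ≡⟨ lem n (m (x ∷ xs)) (m xs) m′ l d k ⟩
          k * + 0 + l * (shuffle σ (t ∷ r) a (x ∷ xs) ys + shuffle σ (t ∷ r) a xs ys)
            ≡⟨ cong₂ (λ s s′ → k * + 0 + l * (s + s′))
                 (trans (shuffle-swap σ (t ∷ r) a (x ∷ xs) ys)
                   (shuffle≡shuffleFrom (not σ) t r a ys (x ∷ xs) et oy (nn (ox ∷ oxs)) uy (x∉xs ∷ uxs)))
                 (trans (shuffle-swap σ (t ∷ r) a xs ys) (shuffle≡shuffleFrom (not σ) t r a ys xs et oy (nn oxs) uy uxs)) ⟩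
          k * + 0 + l * (shuffleFrom (not σ) (t ∷ r) a ys (x ∷ xs) + shuffleFrom (not σ) (t ∷ r) a ys xs) ∎
        where
        nn : ∀ {as} → OnSide σ as → OnSide (not (not σ)) as
        nn rewrite not-involutive σ = λ z → z
        lem : ∀ n m₁ m₂ m′ l d k → n * ((m₁ + m₂) * (m′ * (l * d))) ≡
          k * + 0 + l * (n * (m₁ * (m′ * d)) + n * (m₂ * (m′ * d)))
        lem = solve-∀

-- Compositions as binary words

κ : List Bool → Composition
κ bs = bitsToComp bs 1

κ′ : Maybe (List Bool) → Composition
κ′ nothing  = []
κ′ (just x) = κ x

-- Exposes the first part, which is never below the counter `c`, so that functions defined by
-- matching on a composition reduce.
bitsToComp-∷ : ∀ bs c → ∃ λ k → ∃ λ r → bitsToComp bs c ≡ (k ℕ.+ c) ∷ r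
bitsToComp-∷ []           c = 0 , [] , refl
bitsToComp-∷ (true ∷ bs)  c = 0 , κ bs , refl
bitsToComp-∷ (false ∷ bs) c with k , r , e ← bitsToComp-∷ bs (suc c) =
  suc k , r , trans e (cong (_∷ r) (ℕ.+-suc k c))

bitsToComp-valid : ∀ bs c → 0 < c → IsComposition (bitsToComp bs c)
bitsToComp-valid []           c 0<c = 0<c ∷ []
bitsToComp-valid (true ∷ bs)  c 0<c = 0<c ∷ bitsToComp-valid bs 1 (s≤s z≤n)
bitsToComp-valid (false ∷ bs) c 0<c = bitsToComp-valid bs (suc c) (s≤s z≤n)

κ′-valid : ∀ X → IsComposition (κ′ X)
κ′-valid nothing  = []
κ′-valid (just x) = bitsToComp-valid x 1 (s≤s z≤n)

size-bitsToComp : ∀ bs c → size (bitsToComp bs c) ≡ length bs ℕ.+ c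
size-bitsToComp []           c = ℕ.+-identityʳ c
size-bitsToComp (true ∷ bs)  c = trans (cong (c ℕ.+_) (size-bitsToComp bs 1)) (trans (ℕ.+-comm c _) (cong (ℕ._+ c) (ℕ.+-comm _ 1)))
size-bitsToComp (false ∷ bs) c = trans (size-bitsToComp bs (suc c)) (ℕ.+-suc _ c)

size-κ : ∀ bs → size (κ bs) ≡ suc (length bs)
size-κ bs = trans (size-bitsToComp bs 1) (ℕ.+-comm _ 1)

κ-surjective : ∀ x r → 0 < x → IsComposition r → ∃ λ bs → κ bs ≡ x ∷ r
κ-surjective (suc d) r _ ok = subst (λ t → ∃ λ bs → κ bs ≡ t ∷ r) (ℕ.+-comm d 1) (grow d 1 r ok)
  where
  grow : ∀ d c r → IsComposition r → ∃ λ bs → bitsToComp bs c ≡ (d ℕ.+ c) ∷ r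
  grow zero    c []      []      = [] , refl
  grow zero    c (x ∷ r) (p ∷ ok) with bs , e ← κ-surjective x r p ok = true ∷ bs , cong (c ∷_) e
  grow (suc d) c r       ok       with bs , e ← grow d (suc c) r ok =
    false ∷ bs , trans e (cong (_∷ r) (ℕ.+-suc d c))

suc+≡ᵇ : ∀ k c → (k ℕ.+ suc c ≡ᵇ c) ≡ false
suc+≡ᵇ k c = ≡ᵇ-false (k ℕ.+ suc c) c (λ e → ℕ.<⇒≢ (ℕ.≤-trans (ℕ.n<1+n c) (ℕ.m≤n+m (suc c) k)) (sym e))

≡ᵇ-suc+ : ∀ k c → (c ≡ᵇ k ℕ.+ suc c) ≡ false
≡ᵇ-suc+ k c = ≡ᵇ-false c (k ℕ.+ suc c) (λ e → ℕ.<⇒≢ (ℕ.≤-trans (ℕ.n<1+n c) (ℕ.m≤n+m (suc c) k)) e)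

-- With a common counter, a first difference between `true` and `false` makes one part equal to `c`
-- and the other larger; a word that ends early differs in the number of parts or in the size of the
-- last one.
eqℕs-bitsToComp : ∀ x y c → ⟦ eqℕs (bitsToComp x c) (bitsToComp y c) ⟧ ≡ ind x y
eqℕs-bitsToComp [] [] c rewrite ≡ᵇ-refl c = refl
eqℕs-bitsToComp [] (true ∷ y) c with k , r , e ← bitsToComp-∷ y 1 rewrite e | ≡ᵇ-refl c = refl
eqℕs-bitsToComp [] (false ∷ y) c with k , r , e ← bitsToComp-∷ y (suc c) rewrite e | ≡ᵇ-suc+ k c = refl
eqℕs-bitsToComp (true ∷ x) [] c with k , r , e ← bitsToComp-∷ x 1 rewrite e | ≡ᵇ-refl c = refl
eqℕs-bitsToComp (false ∷ x) [] c with k , r , e ← bitsToComp-∷ x (suc c) rewrite e | suc+≡ᵇ k c = refl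
eqℕs-bitsToComp (true ∷ x) (true ∷ y) c rewrite ≡ᵇ-refl c = trans (eqℕs-bitsToComp x y 1) (sym (ℤ.*-identityˡ (ind x y)))
eqℕs-bitsToComp (true ∷ x) (false ∷ y) c with k , r , e ← bitsToComp-∷ y (suc c) rewrite e | ≡ᵇ-suc+ k c = sym (ℤ.*-zeroˡ (ind x y))
eqℕs-bitsToComp (false ∷ x) (true ∷ y) c with k , r , e ← bitsToComp-∷ x (suc c) rewrite e | suc+≡ᵇ k c = sym (ℤ.*-zeroˡ (ind x y))
eqℕs-bitsToComp (false ∷ x) (false ∷ y) c = trans (eqℕs-bitsToComp x y (suc c)) (sym (ℤ.*-identityˡ (ind x y)))

κ-injective : ∀ x y → κ x ≡ κ y → x ≡ y
κ-injective x y e = ind-eq x y (trans (sym (eqℕs-bitsToComp x y 1))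
  (trans (cong (λ t → ⟦ eqℕs t (κ y) ⟧) e) (trans (eqℕs-bitsToComp y y 1) (ind-refl y))))
  where
  ind-refl : ∀ x → ind x x ≡ + 1
  ind-refl []      = refl
  ind-refl (c ∷ x) rewrite ==-refl c = trans (ℤ.*-identityˡ _) (ind-refl x)
  ind-eq : ∀ x y → ind x y ≡ + 1 → x ≡ y
  ind-eq []          []          e = refl
  ind-eq (true ∷ x)  (true ∷ y)  e = cong (true ∷_) (ind-eq x y (trans (sym (ℤ.*-identityˡ (ind x y))) e))
  ind-eq (false ∷ x) (false ∷ y) e = cong (false ∷_) (ind-eq x y (trans (sym (ℤ.*-identityˡ (ind x y))) e))
  ind-eq (true ∷ x)  (false ∷ y) e = case trans (sym e) (ℤ.*-zeroˡ (ind x y)) of λ ()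
  ind-eq (false ∷ x) (true ∷ y)  e = case trans (sym e) (ℤ.*-zeroˡ (ind x y)) of λ ()

-- For `i = 1` this is the set S_α of the composition α encoded by the word.
positions : ℕ → List Bool → List ℕ
positions i []           = []
positions i (true ∷ bs)  = i ∷ positions (suc i) bs
positions i (false ∷ bs) = positions (suc i) bs

-- Here `p` is the last cut and `c` the number of boxes read since, so `p + c` is the next possible
-- cut as well as the number of boxes read so far.
diffs-positions : ∀ p c bs → diffs p (positions (p ℕ.+ c) bs) (p ℕ.+ c ℕ.+ length bs) ≡ bitsToComp bs c
diffs-positions p c [] = cong (_∷ []) (trans (cong (_∸ p) (ℕ.+-identityʳ (p ℕ.+ c))) (ℕ.m+n∸m≡n p c))
diffs-positions p c (true ∷ bs) = cong₂ _∷_ (ℕ.m+n∸m≡n p c)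
  (trans (cong₂ (λ i n → diffs (p ℕ.+ c) (positions i bs) n) (ℕ.+-comm 1 (p ℕ.+ c))
     (trans (ℕ.+-suc (p ℕ.+ c) _) (cong (ℕ._+ length bs) (ℕ.+-comm 1 (p ℕ.+ c)))))
   (diffs-positions (p ℕ.+ c) 1 bs))
diffs-positions p c (false ∷ bs) =
  trans (cong₂ (λ i n → diffs p (positions i bs) n) (sym (ℕ.+-suc p c))
    (trans (ℕ.+-suc (p ℕ.+ c) _) (cong (ℕ._+ length bs) (sym (ℕ.+-suc p c)))))
  (diffs-positions p (suc c) bs)

desFrom-positions : ∀ i u → desFrom i u ≡ positions i (des u)
desFrom-positions i []          = refl
desFrom-positions i (x ∷ [])    = refl
desFrom-positions i (x ∷ y ∷ u) with y <ᵇ x | desFrom-positions (suc i) (y ∷ u)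
... | true  | e = cong (i ∷_) e
... | false | e = e

length-des : ∀ x u → length (des (x ∷ u)) ≡ length u
length-des x []      = refl
length-des x (y ∷ u) = cong suc (length-des y u)

compOfWord-κ : ∀ u → compOfWord u ≡ κ′ (desWord u)
compOfWord-κ []      = refl
compOfWord-κ (x ∷ u) = trans
  (cong₂ (diffs 0) (desFrom-positions 1 (x ∷ u)) (cong suc (sym (length-des x u))))
  (diffs-positions 0 1 (des (x ∷ u)))

κ′-injective : ∀ X Y → κ′ X ≡ κ′ Y → X ≡ Y
κ′-injective nothing  nothing  e = refl
κ′-injective nothing  (just y) e with _ , _ , e′ ← bitsToComp-∷ y 1 = case trans e e′ of λ ()
κ′-injective (just x) nothing  e with _ , _ , e′ ← bitsToComp-∷ x 1 = case trans (sym e) e′ of λ ()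
κ′-injective (just x) (just y) e = cong just (κ-injective x y e)

desWord-shift : ∀ p u → desWord (shift p u) ≡ desWord u
desWord-shift p []      = refl
desWord-shift p (x ∷ u) = cong just (des-shift x u)
  where
  +ᵇ : ∀ x y p → (x ℕ.+ p <ᵇ y ℕ.+ p) ≡ (x <ᵇ y)
  +ᵇ x y zero    rewrite ℕ.+-identityʳ x | ℕ.+-identityʳ y = refl
  +ᵇ x y (suc p) rewrite ℕ.+-suc x p | ℕ.+-suc y p = +ᵇ x y p
  des-shift : ∀ x u → des (shift p (x ∷ u)) ≡ des (x ∷ u)
  des-shift x []      = refl
  des-shift x (y ∷ u) = cong₂ _∷_ (+ᵇ y x p) (des-shift y u)

-- The coefficients of the coproduct

∑-cong∈ : ∀ {A : Set} (L : List A) {f g : A → ℤ} → (∀ x → x ∈ L → f x ≡ g x) → ∑ L f ≡ ∑ L g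
∑-cong∈ L e = ∑-congAll (All.tabulate (e _))

∑-words-cong : ∀ L N {f g} → (∀ u → length u ≡ L → All (InRange N) u → f u ≡ g u) →
  ∑ (words L N) f ≡ ∑ (words L N) g
∑-words-cong zero    N e = cong (_+ + 0) (e [] refl [])
∑-words-cong (suc L) N {f} {g} e = begin
  ∑ (words (suc L) N) f ≡⟨ ∑-words L N f ⟩
  ∑ (map suc (upTo N)) (λ z → ∑ (words L N) (λ u → f (z ∷ u)))
    ≡⟨ ∑-cong∈ (map suc (upTo N)) (λ z z∈ → ∑-words-cong L N (λ u l r → e (z ∷ u) (cong suc l) (z∈ ∷ r))) ⟩
  ∑ (map suc (upTo N)) (λ z → ∑ (words L N) (λ u → g (z ∷ u))) ≡⟨ ∑-words L N g ⟨
  ∑ (words (suc L) N) g ∎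

elem-∈ : ∀ {z} {xs : List ℕ} → z ∈ xs → elem z xs ≡ true
elem-∈ {z} (here refl) rewrite ≡ᵇ-refl z = refl
elem-∈ {z} (there {x = x} p) with z ≡ᵇ x
... | true  = refl
... | false = elem-∈ p

elem-∉ : ∀ {z} {xs : List ℕ} → All (z ≢_) xs → elem z xs ≡ false
elem-∉ []                           = refl
elem-∉ {z} (_∷_ {x = x} p ps) rewrite ≡ᵇ-false z x p = elem-∉ ps

-- `A₀` and `B₀` stand for w_β and the shifted w_δ, with p = |β| and N = |β| + |δ|. By `complete`,
-- membership tests become comparisons with `p`.
module _ (p N : ℕ) (A₀ B₀ : List ℕ)
  (onA : OnSide p false A₀) (onB : OnSide p true B₀)
  (uniqueA : Unique A₀) (uniqueB : Unique B₀)
  (rangeA : All (InRange N) A₀) (rangeB : All (InRange N) B₀)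
  (complete : ∀ z → InRange N z → elem z A₀ ≡ not (side p z) × elem z B₀ ≡ side p z)
  where

  subwordOf-A : ∀ {u} → All (InRange N) u → subwordOf A₀ u ≡ restrict p false u
  subwordOf-A []               = refl
  subwordOf-A (_∷_ {x = z} r rs) rewrite proj₁ (complete z r) with side p z
  ... | true  = subwordOf-A rs
  ... | false = cong (z ∷_) (subwordOf-A rs)

  subwordOf-B : ∀ {u} → All (InRange N) u → subwordOf B₀ u ≡ restrict p true u
  subwordOf-B []               = refl
  subwordOf-B (_∷_ {x = z} r rs) rewrite proj₂ (complete z r) with side p z
  ... | true  = cong (z ∷_) (subwordOf-B rs)
  ... | false = subwordOf-B rs

  letters : ∀ {u} → All (InRange N) u → all (λ x → elem x A₀ ∨ elem x B₀) u ≡ true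
  letters []               = refl
  letters (_∷_ {x = z} r rs) rewrite proj₁ (complete z r) | proj₂ (complete z r) with side p z
  ... | true  = letters rs
  ... | false = letters rs

  isMultishuffle-shuffle : ∀ z u a → All (InRange N) (z ∷ u) →
    ⟦ isMultishuffle A₀ B₀ (z ∷ u) ∧ eqℕs (compOfWord (z ∷ u)) (κ a) ⟧ ≡ shuffle p false (z ∷ u) a A₀ B₀
  isMultishuffle-shuffle z u a r
    rewrite letters r | subwordOf-A r | subwordOf-B r | compOfWord-κ (z ∷ u) = trans (⟦∧⟧ (n ∧ (m ∧ m′)) _) (trans
      (cong₂ _*_ (trans (⟦∧⟧ n _) (cong (⟦ n ⟧ *_) (⟦∧⟧ m m′))) (eqℕs-bitsToComp (des (z ∷ u)) a 1))
      (lem ⟦ n ⟧ ⟦ m ⟧ ⟦ m′ ⟧ (ind (des (z ∷ u)) a)))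
    where
    n m m′ : Bool
    n = noAdjEq (z ∷ u)
    m = isMultiword (restrict p false (z ∷ u)) A₀
    m′ = isMultiword (restrict p true (z ∷ u)) B₀
    lem : ∀ a b c d → a * (b * c) * d ≡ a * (b * (c * d))
    lem = solve-∀

  -- The side of the first letter decides which of the two terms vanishes.
  shuffle-split : ∀ z u a → shuffle p false (z ∷ u) a A₀ B₀ ≡ shuffleFrom false (z ∷ u) a A₀ B₀ + shuffleFrom true (z ∷ u) a B₀ A₀
  shuffle-split z u a = side-cases p false z
    (λ e → trans (shuffle≡shuffleFrom p false z u a A₀ B₀ e onA onB uniqueA uniqueB)
      (trans (sym (ℤ.+-identityʳ (shuffleFrom false (z ∷ u) a A₀ B₀)))
        (cong (λ t → shuffleFrom false (z ∷ u) a A₀ B₀ + t) (sym (shuffleFrom-unmatched true z u a B₀ A₀ (off-side p true z e onB))))))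
    (λ e → trans (shuffle-swap p false (z ∷ u) a A₀ B₀) (trans (shuffle≡shuffleFrom p true z u a B₀ A₀ e onB onA uniqueB uniqueA)
      (trans (sym (ℤ.+-identityˡ (shuffleFrom true (z ∷ u) a B₀ A₀)))
        (cong (_+ shuffleFrom true (z ∷ u) a B₀ A₀) (sym (shuffleFrom-unmatched false z u a A₀ B₀ (off-side p false z e onA)))))))

  count-multishuffles : ∀ a →
    + count (λ u → isMultishuffle A₀ B₀ u ∧ eqℕs (compOfWord u) (κ a)) (words (suc (length a)) N) ≡
    Δ₁ false a (ind² (desWord A₀) (desWord B₀)) + Δ₁ true a (ind² (desWord B₀) (desWord A₀))
  count-multishuffles a = begin
    + count good W ≡⟨ ∑-count good W ⟩
    ∑ W (λ u → ⟦ good u ⟧)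
      ≡⟨ ∑-words-cong (suc (length a)) N (λ { (z ∷ u) _ r → trans (isMultishuffle-shuffle z u a r) (shuffle-split z u a) }) ⟩
    ∑ W (λ u → shuffleFrom false u a A₀ B₀ + shuffleFrom true u a B₀ A₀)
      ≡⟨ ∑-+ W (λ u → shuffleFrom false u a A₀ B₀) (λ u → shuffleFrom true u a B₀ A₀) ⟩
    ∑ W (λ u → shuffleFrom false u a A₀ B₀) + ∑ W (λ u → shuffleFrom true u a B₀ A₀)
      ≡⟨ cong₂ _+_ (∑-shuffleFrom N false a A₀ B₀ rangeA rangeB) (∑-shuffleFrom N true a B₀ A₀ rangeB rangeA) ⟩
    Δ₁ false a (ind² (desWord A₀) (desWord B₀)) + Δ₁ true a (ind² (desWord B₀) (desWord A₀)) ∎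
    where
    W : List (List ℕ)
    W = words (suc (length a)) N
    good : List ℕ → Bool
    good u = isMultishuffle A₀ B₀ u ∧ eqℕs (compOfWord u) (κ a)

∈-range : ∀ {N z} → 0 < z → z ≤ N → InRange N z
∈-range {N} {suc z} _ z<N = ∈-map⁺ suc (∈-upTo⁺ z<N)

range-∈ : ∀ {N z} → InRange N z → 0 < z × z ≤ N
range-∈ r with _ , z∈ , refl ← ∈-map⁻ suc r = s≤s z≤n , ∈-upTo⁻ z∈

module _ (w : Composition → List ℕ) (perm : IsPermChoice w) where

  desWord-w : ∀ X → desWord (w (κ′ X)) ≡ X
  desWord-w X = κ′-injective (desWord (w (κ′ X))) X (trans (sym (compOfWord-κ (w (κ′ X)))) (proj₂ (perm (κ′ X) (κ′-valid X))))

  -- The two terms count the multishuffles beginning with a letter of the first word and of the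
  -- second. Only the descent words of the chosen permutations survive, so the coefficient does not
  -- depend on the choice.
  coprodCoeff-Δ₁ : ∀ a X Y → + coprodCoeff w (κ a) (κ′ X) (κ′ Y) ≡
    Δ₁ false a (ind² X Y) + Δ₁ true a (ind² Y X)
  coprodCoeff-Δ₁ a X Y rewrite size-κ a = trans
    (count-multishuffles p (p ℕ.+ r) A B onA onB
      (unique X) (Unique.map⁺ (λ {x} {y} → ℕ.+-cancelʳ-≡ p x y) (unique Y))
      (All.map (λ z∈ → let l , u = range-∈ z∈ in ∈-range l (ℕ.≤-trans u (ℕ.m≤m+n p r))) (ranges X))
      (map⁺ (All.map (λ {z} z∈ → let l , u = range-∈ z∈ in ∈-range (ℕ.≤-trans l (ℕ.m≤m+n z p))
        (subst (z ℕ.+ p ≤_) (ℕ.+-comm r p) (ℕ.+-monoˡ-≤ p u))) (ranges Y)))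
      complete a)
    (cong₂ (λ X Y → Δ₁ false a (ind² X Y) + Δ₁ true a (ind² Y X)) (desWord-w X) (trans (desWord-shift p (w (κ′ Y))) (desWord-w Y)))
    where
    p r : ℕ
    p = size (κ′ X)
    r = size (κ′ Y)
    A B : List ℕ
    A = w (κ′ X)
    B = shift p (w (κ′ Y))
    permutes : ∀ X → w (κ′ X) ↭ map suc (upTo (size (κ′ X)))
    permutes X = proj₁ (perm (κ′ X) (κ′-valid X))
    unique : ∀ X → Unique (w (κ′ X))
    unique X = Permutation.Unique-resp-↭ (setoid ℕ) (↭⇒↭ₛ (↭-sym (permutes X))) (Unique.map⁺ ℕ.suc-injective (Unique.upTo⁺ _))
    ranges : ∀ X → All (InRange (size (κ′ X))) (w (κ′ X))
    ranges X = All.tabulate (∈-resp-↭ (permutes X))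
    onA : OnSide p false A
    onA = All.map (λ {z} z∈ → <ᵇ-false p z (proj₂ (range-∈ z∈))) (ranges X)
    onB : OnSide p true B
    onB = map⁺ (All.map (λ {z} z∈ → <ᵇ-true p (z ℕ.+ p) (ℕ.+-monoˡ-≤ p (proj₁ (range-∈ z∈)))) (ranges Y))
    complete : ∀ z → InRange (p ℕ.+ r) z → elem z A ≡ not (side p z) × elem z B ≡ side p z
    complete z z∈ = side-cases p false z
      (λ e → trans (elem-∈ {z} {A} (∈-resp-↭ (↭-sym (permutes X)) (∈-range (proj₁ (range-∈ z∈)) (side-false p z e)))) (cong not (sym e))
           , trans (elem-∉ {z} {B} (off-side p true z e onB)) (sym e))
      (λ e → trans (elem-∉ {z} {A} (off-side p false z e onA)) (cong not (sym e))
           , trans (elem-∈ (subst (_∈ B) (ℕ.m∸n+n≡m (ℕ.<⇒≤ (side-true p z e)))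
               (∈-map⁺ (ℕ._+ p) (∈-resp-↭ (↭-sym (permutes Y))
                 (∈-range (ℕ.m<n⇒0<n∸m (side-true p z e))
                   (subst (z ∸ p ≤_) (ℕ.m+n∸m≡n p r) (ℕ.∸-monoˡ-≤ p (proj₂ (range-∈ z∈))))))))) (sym e))

-- Linear functionals on MNSym

∑-swap : ∀ {A B : Set} (L : List A) (M : List B) (f : A → B → ℤ) →
  ∑ L (λ x → ∑ M (f x)) ≡ ∑ M (λ y → ∑ L (λ x → f x y))
∑-swap []      M f = sym (∑-0 M)
∑-swap (x ∷ L) M f = trans (cong (λ t → ∑ M (f x) + t) (∑-swap L M f)) (sym (∑-+ M (f x) _))

-- The linear extension of `f`, evaluated at the element. Arbitrary functionals are allowed, and not
-- only coefficients, so that multiplication by a basis element can be absorbed into `f`.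
pairing : LC → (Composition → ℤ) → ℤ
pairing x f = ∑ x (λ t → proj₁ t * f (proj₂ t))

δ : Composition → Composition → ℤ
δ γ β = ⟦ eqℕs β γ ⟧

coeff-pairing : ∀ x γ → coeff x γ ≡ pairing x (δ γ)
coeff-pairing []            γ = refl
coeff-pairing ((a , β) ∷ x) γ = cong₂ _+_ (if-* (eqℕs β γ)) (coeff-pairing x γ)
  where
  if-* : ∀ b → (if b then a else + 0) ≡ a * ⟦ b ⟧
  if-* true  = sym (ℤ.*-identityʳ a)
  if-* false = sym (ℤ.*-zeroʳ a)

eqℕs-true : ∀ x y → eqℕs x y ≡ true → x ≡ y
eqℕs-true []      []      e = refl
eqℕs-true (a ∷ x) (b ∷ y) e with a ≡ᵇ b in ab
... | true = cong₂ _∷_ (≡ᵇ-true a b ab) (eqℕs-true x y e)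

eqℕs-refl : ∀ x → eqℕs x x ≡ true
eqℕs-refl []      = refl
eqℕs-refl (a ∷ x) rewrite ≡ᵇ-refl a = eqℕs-refl x

remove : Composition → LC → LC
remove β []            = []
remove β ((b , η) ∷ x) = if eqℕs η β then remove β x else (b , η) ∷ remove β x

remove-length : ∀ β x → length (remove β x) ≤ length x
remove-length β []            = z≤n
remove-length β ((b , η) ∷ x) with eqℕs η β
... | true  = ℕ.m≤n⇒m≤1+n (remove-length β x)
... | false = s≤s (remove-length β x)

pairing-remove : ∀ β x f → pairing x f ≡ coeff x β * f β + pairing (remove β x) f
pairing-remove β []            f = sym (trans (ℤ.+-identityʳ _) (ℤ.*-zeroˡ (f β)))
pairing-remove β ((b , η) ∷ x) f with eqℕs η β in e
... | true rewrite eqℕs-true η β e = trans (cong (λ t → b * f β + t) (pairing-remove β x f))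
    (lem b (f β) (coeff x β) (pairing (remove β x) f))
  where
  lem : ∀ b f c p → b * f + (c * f + p) ≡ (b + c) * f + p
  lem = solve-∀
... | false = trans (cong (λ t → b * f η + t) (pairing-remove β x f))
    (lem (b * f η) (f β) (coeff x β) (pairing (remove β x) f))
  where
  lem : ∀ b f c p → b + (c * f + p) ≡ (+ 0 + c) * f + (b + p)
  lem = solve-∀

-- `remove` takes out all terms of one composition at once; their coefficients add up to 0 and the
-- other coefficients stay 0. The bound `n` carries the induction, as the remaining list is not a
-- sublist known to the termination checker.
pairing-zero : ∀ n x f → length x ≤ n → (∀ γ → coeff x γ ≡ + 0) → pairing x f ≡ + 0
pairing-zero n       []                f _         _  = refl
pairing-zero (suc n) x@((b , β) ∷ x′) f (s≤s len) x≈0 = begin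
  pairing x f                             ≡⟨ pairing-remove β x f ⟩
  coeff x β * f β + pairing (remove β x) f ≡⟨ cong₂ (λ s t → s * f β + t) (x≈0 β)
    (pairing-zero n (remove β x) f (subst (λ y → length y ≤ n) (sym removed) (ℕ.≤-trans (remove-length β x′) len)) rest≈0) ⟩
  + 0 * f β + + 0                         ≡⟨ trans (ℤ.+-identityʳ _) (ℤ.*-zeroˡ (f β)) ⟩
  + 0                                     ∎
  where
  removed : remove β x ≡ remove β x′
  removed rewrite eqℕs-refl β = refl
  rest≈0 : ∀ γ → coeff (remove β x) γ ≡ + 0
  rest≈0 γ = begin
    coeff (remove β x) γ                            ≡⟨ coeff-pairing (remove β x) γ ⟩
    pairing (remove β x) (δ γ)                      ≡⟨ ℤ.+-identityˡ _ ⟨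
    + 0 + pairing (remove β x) (δ γ)                ≡⟨ cong (_+ pairing (remove β x) (δ γ)) (ℤ.*-zeroˡ (δ γ β)) ⟨
    + 0 * δ γ β + pairing (remove β x) (δ γ)        ≡⟨ cong (λ t → t * δ γ β + pairing (remove β x) (δ γ)) (x≈0 β) ⟨
    coeff x β * δ γ β + pairing (remove β x) (δ γ)  ≡⟨ pairing-remove β x (δ γ) ⟨
    pairing x (δ γ)                                 ≡⟨ coeff-pairing x γ ⟨
    coeff x γ                                       ≡⟨ x≈0 γ ⟩
    + 0                                             ∎

pairing-scale : ∀ c x f → pairing (scale c x) f ≡ c * pairing x f
pairing-scale c x f = trans (∑-map _ x _) (trans (∑-cong x (λ t → ℤ.*-assoc c (proj₁ t) (f (proj₂ t)))) (∑-*ˡ x c _))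

pairing-cong : ∀ x f g → (∀ β → f β ≡ g β) → pairing x f ≡ pairing x g
pairing-cong x f g e = ∑-cong x (λ t → cong (proj₁ t *_) (e (proj₂ t)))

-- A list may mention a composition several times, so `≈` does not identify the lists; but their
-- formal difference has all coefficients 0.
pairing-≈ : ∀ x y f → x ≈ y → pairing x f ≡ pairing y f
pairing-≈ x y f x≈y = ℤ.i-j≡0⇒i≡j (pairing x f) (pairing y f)
  (trans (sym (difference f)) (pairing-zero _ z f ℕ.≤-refl λ γ → begin
  coeff z γ                  ≡⟨ coeff-pairing z γ ⟩
  pairing z (δ γ)            ≡⟨ difference (δ γ) ⟩
  pairing x (δ γ) + - pairing y (δ γ) ≡⟨ cong₂ (λ s t → s + - t) (sym (coeff-pairing x γ)) (sym (coeff-pairing y γ)) ⟩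
  coeff x γ + - coeff y γ    ≡⟨ cong (λ t → t + - coeff y γ) (x≈y γ) ⟩
  coeff y γ + - coeff y γ    ≡⟨ ℤ.+-inverseʳ (coeff y γ) ⟩
  + 0 ∎))
  where
  z : LC
  z = x ++ scale (- (+ 1)) y
  difference : ∀ f → pairing z f ≡ pairing x f + - pairing y f
  difference f = trans (∑-++ x _ _) (cong (λ t → pairing x f + t) (trans (pairing-scale (- (+ 1)) y f) (ℤ.-1*i≡-i _)))

pairing-basis : ∀ β f → pairing (basis β) f ≡ f β
pairing-basis β f = trans (ℤ.+-identityʳ _) (ℤ.*-identityˡ (f β))

pairing-mul-basis : ∀ β y f → pairing (mul (basis β) y) f ≡ pairing y (λ η → pairing (mulBasis β η) f)
pairing-mul-basis β y f = begin
  pairing (mul (basis β) y) f ≡⟨ trans (∑-++ (concatMap _ y) [] _) (ℤ.+-identityʳ _) ⟩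
  pairing (concatMap (λ t → scale (+ 1 * proj₁ t) (mulBasis β (proj₂ t))) y) f
    ≡⟨ ∑-concatMap (λ t → scale (+ 1 * proj₁ t) (mulBasis β (proj₂ t))) y _ ⟩
  ∑ y (λ t → pairing (scale (+ 1 * proj₁ t) (mulBasis β (proj₂ t))) f)
    ≡⟨ ∑-cong y (λ t → trans (pairing-scale (+ 1 * proj₁ t) (mulBasis β (proj₂ t)) f)
         (cong (_* pairing (mulBasis β (proj₂ t)) f) (ℤ.*-identityˡ (proj₁ t)))) ⟩
  pairing y (λ η → pairing (mulBasis β η) f) ∎

-- The product on binary words

-- The completed parts and the unfinished last part; the latter is the counter with which an
-- appended word goes on.
lastSplit : List Bool → ℕ → List ℕ × ℕ
lastSplit []          c = [] , c
lastSplit (true ∷ x)  c = c ∷ proj₁ (lastSplit x 1) , proj₂ (lastSplit x 1)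
lastSplit (false ∷ x) c = lastSplit x (suc c)

lastSplit-positive : ∀ x c → ∃ λ l → proj₂ (lastSplit x (suc c)) ≡ suc l
lastSplit-positive []          c = c , refl
lastSplit-positive (true ∷ x)  c = lastSplit-positive x 0
lastSplit-positive (false ∷ x) c = lastSplit-positive x (suc c)

bitsToComp-++ : ∀ x c z → bitsToComp (x ++ z) c ≡ proj₁ (lastSplit x c) ++ bitsToComp z (proj₂ (lastSplit x c))
bitsToComp-++ []          c z = refl
bitsToComp-++ (true ∷ x)  c z = cong (c ∷_) (bitsToComp-++ x 1 z)
bitsToComp-++ (false ∷ x) c z = bitsToComp-++ x (suc c) z

initLast-lastSplit : ∀ x c {b β} → bitsToComp x c ≡ b ∷ β → initLast b β ≡ lastSplit x c
initLast-lastSplit []          c refl = refl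
initLast-lastSplit (true ∷ x)  c refl with _ , _ , e ← bitsToComp-∷ x 1
  rewrite e | initLast-lastSplit x 1 e = refl
initLast-lastSplit (false ∷ x) c e = initLast-lastSplit x (suc c) e

bitsToComp-+ : ∀ k z c {b β} → bitsToComp z c ≡ b ∷ β → bitsToComp z (k ℕ.+ c) ≡ (k ℕ.+ b) ∷ β
bitsToComp-+ k []          c refl = refl
bitsToComp-+ k (true ∷ z)  c refl = refl
bitsToComp-+ k (false ∷ z) c e = trans (cong (bitsToComp z) (sym (ℕ.+-suc k c))) (bitsToComp-+ k z (suc c) e)

mulBasis-∷ : ∀ a α b β f {i l} → initLast a α ≡ (i , l) → pairing (mulBasis (a ∷ α) (b ∷ β)) f ≡
  f (i ++ l ∷ b ∷ β) + f (i ++ ((l ℕ.+ b) ∸ 1) ∷ β) + f (i ++ (l ℕ.+ b) ∷ β)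
mulBasis-∷ a α b β f {i} {l} e rewrite e = lem (f (i ++ l ∷ b ∷ β)) (f (i ++ ((l ℕ.+ b) ∸ 1) ∷ β)) (f (i ++ (l ℕ.+ b) ∷ β))
  where
  lem : ∀ a b c → + 1 * a + (+ 1 * b + (+ 1 * c + + 0)) ≡ a + b + c
  lem = solve-∀

mulBasis-κ : ∀ x z f → pairing (mulBasis (κ x) (κ z)) f ≡ join (λ t → f (κ t)) x z
mulBasis-κ x z f
  with h₁ , α , ex ← bitsToComp-∷ x 1
     | h₂ , β , ez ← bitsToComp-∷ z 1
     | l , el ← lastSplit-positive x 0
  = trans (cong₂ (λ s t → pairing (mulBasis s t) f) ex ez) (trans (mulBasis-∷ _ α _ β f (initLast-lastSplit x 1 ex))
    (cong₂ _+_ (cong₂ _+_ (cong f (sym first)) (cong f (sym second))) (cong f (sym third))))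
  where
  i : List ℕ
  i = proj₁ (lastSplit x 1)
  m b : ℕ
  m = proj₂ (lastSplit x 1)
  b = h₂ ℕ.+ 1
  first : κ (x ++ true ∷ z) ≡ i ++ m ∷ b ∷ β
  first = trans (bitsToComp-++ x 1 (true ∷ z)) (cong (λ t → i ++ m ∷ t) ez)
  -- Without a letter in between, the first box of `z` is the last box of `x`, so one box is lost.
  -- `lastSplit-positive` makes the truncated subtraction a true one.
  second : κ (x ++ z) ≡ i ++ (m ℕ.+ b ∸ 1) ∷ β
  second = trans (bitsToComp-++ x 1 z) (cong (i ++_)
    (subst (λ m → bitsToComp z m ≡ (m ℕ.+ b ∸ 1) ∷ β) (sym el)
      (trans (cong (bitsToComp z) (ℕ.+-comm 1 l)) (bitsToComp-+ l z 1 ez))))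
  third : κ (x ++ false ∷ z) ≡ i ++ (m ℕ.+ b) ∷ β
  third = trans (bitsToComp-++ x 1 (false ∷ z)) (cong (i ++_)
    (trans (cong (bitsToComp z) (ℕ.+-comm 1 m)) (bitsToComp-+ m z 1 ez)))

mulBasis-∅ʳ : ∀ x f → pairing (mulBasis (κ x) []) f ≡ f (κ x)
mulBasis-∅ʳ x f with _ , _ , e ← bitsToComp-∷ x 1 rewrite e = pairing-basis _ f

-- Summation over all compositions

-- A word of length m encodes a composition of m + 1, so `nothing` and the lengths below `n` give
-- the sizes up to `n`.
maybeBools : ℕ → List (Maybe (List Bool))
maybeBools n = nothing ∷ concatMap (λ m → map just (bools m)) (upTo n)

∑-maybeBools : ∀ n f → ∑ (maybeBools n) f ≡ f nothing + ∑ (upTo n) (λ m → ∑ (bools m) (λ x → f (just x)))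
∑-maybeBools n f = cong (λ t → f nothing + t)
  (trans (∑-concatMap (λ m → map just (bools m)) (upTo n) f) (∑-cong (upTo n) (λ m → ∑-map just (bools m) f)))

∑-compsUpTo : ∀ n f → ∑ (compsUpTo n) f ≡ ∑ (maybeBools n) (λ X → f (κ′ X))
∑-compsUpTo n f = begin
  ∑ (compsUpTo n) f ≡⟨ ∑-concatMap compsOf (upTo (suc n)) f ⟩
  f [] + + 0 + ∑ (applyUpTo suc n) (λ m → ∑ (compsOf m) f)
    ≡⟨ cong₂ (λ s t → s + ∑ t (λ m → ∑ (compsOf m) f)) (ℤ.+-identityʳ (f [])) (sym (map-upTo suc n)) ⟩
  f [] + ∑ (map suc (upTo n)) (λ m → ∑ (compsOf m) f)
    ≡⟨ cong (λ t → f [] + t) (∑-map suc (upTo n) (λ m → ∑ (compsOf m) f)) ⟩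
  f [] + ∑ (upTo n) (λ m → ∑ (map κ (bools m)) f)
    ≡⟨ cong (λ t → f [] + t) (∑-cong (upTo n) (λ m → ∑-map κ (bools m) f)) ⟩
  f [] + ∑ (upTo n) (λ m → ∑ (bools m) (λ x → f (κ x))) ≡⟨ ∑-maybeBools n (λ X → f (κ′ X)) ⟨
  ∑ (maybeBools n) (λ X → f (κ′ X)) ∎

∑-bools : ∀ m f → ∑ (bools (suc m)) f ≡ ∑ (bools m) (λ x → f (false ∷ x)) + ∑ (bools m) (λ x → f (true ∷ x))
∑-bools m f = trans (∑-concatMap _ (bools m) f)
  (trans (∑-cong (bools m) (λ x → cong (λ t → f (false ∷ x) + t) (ℤ.+-identityʳ (f (true ∷ x)))))
    (∑-+ (bools m) (λ x → f (false ∷ x)) (λ x → f (true ∷ x))))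

∑-bools-ind : ∀ m y K → ∑ (bools m) (λ x → ind x y * K x) ≡ ⟦ m ≡ᵇ length y ⟧ * K y
∑-bools-ind zero    []      K = ℤ.+-identityʳ _
∑-bools-ind zero    (c ∷ y) K = trans (ℤ.+-identityʳ _) (trans (ℤ.*-zeroˡ (K [])) (sym (ℤ.*-zeroˡ (K (c ∷ y)))))
∑-bools-ind (suc m) []      K = trans (∑-bools m (λ x → ind x [] * K x))
  (trans (cong₂ _+_ (zero-sum false) (zero-sum true)) (sym (ℤ.*-zeroˡ (K []))))
  where
  zero-sum : ∀ c → ∑ (bools m) (λ x → + 0 * K (c ∷ x)) ≡ + 0
  zero-sum c = trans (∑-cong (bools m) (λ x → ℤ.*-zeroˡ (K (c ∷ x)))) (∑-0 (bools m))
∑-bools-ind (suc m) (c ∷ y) K = trans (∑-bools m (λ x → ind x (c ∷ y) * K x))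
  (trans (cong₂ _+_ (part false) (part true)) (select c))
  where
  part : ∀ d → ∑ (bools m) (λ x → ind (d ∷ x) (c ∷ y) * K (d ∷ x)) ≡ ⟦ d == c ⟧ * (⟦ m ≡ᵇ length y ⟧ * K (d ∷ y))
  part d = trans (∑-cong (bools m) (λ x → ℤ.*-assoc ⟦ d == c ⟧ (ind x y) (K (d ∷ x))))
    (trans (∑-*ˡ (bools m) ⟦ d == c ⟧ _) (cong (⟦ d == c ⟧ *_) (∑-bools-ind m y (λ x → K (d ∷ x)))))
  lem₁ : ∀ a b → + 1 * a + + 0 * b ≡ a
  lem₁ = solve-∀
  lem₂ : ∀ a b → + 0 * a + + 1 * b ≡ b
  lem₂ = solve-∀
  select : ∀ c → ⟦ false == c ⟧ * (⟦ m ≡ᵇ length y ⟧ * K (false ∷ y)) + ⟦ true == c ⟧ * (⟦ m ≡ᵇ length y ⟧ * K (true ∷ y)) ≡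
    ⟦ m ≡ᵇ length y ⟧ * K (c ∷ y)
  select false = lem₁ (⟦ m ≡ᵇ length y ⟧ * K (false ∷ y)) (⟦ m ≡ᵇ length y ⟧ * K (true ∷ y))
  select true  = lem₂ (⟦ m ≡ᵇ length y ⟧ * K (false ∷ y)) (⟦ m ≡ᵇ length y ⟧ * K (true ∷ y))

∑-maybeBools-ind? : ∀ n Y (K : Maybe (List Bool) → ℤ) → ∣ Y ∣ₘ ≤ n → ∑ (maybeBools n) (λ X → ind? X Y * K X) ≡ K Y
∑-maybeBools-ind? n nothing K _ = begin
  ∑ (maybeBools n) (λ X → ind? X nothing * K X) ≡⟨ ∑-maybeBools n (λ X → ind? X nothing * K X) ⟩
  + 1 * K nothing + ∑ (upTo n) (λ m → ∑ (bools m) (λ x → + 0 * K (just x)))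
    ≡⟨ cong₂ _+_ (ℤ.*-identityˡ (K nothing)) (trans (∑-cong (upTo n) (λ m →
         trans (∑-cong (bools m) (λ x → ℤ.*-zeroˡ (K (just x)))) (∑-0 (bools m)))) (∑-0 (upTo n))) ⟩
  K nothing + + 0 ≡⟨ ℤ.+-identityʳ _ ⟩
  K nothing ∎
∑-maybeBools-ind? n (just y) K y<n = begin
  ∑ (maybeBools n) (λ X → ind? X (just y) * K X) ≡⟨ ∑-maybeBools n (λ X → ind? X (just y) * K X) ⟩
  + 0 * K nothing + ∑ (upTo n) (λ m → ∑ (bools m) (λ x → ind x y * K (just x)))
    ≡⟨ cong₂ _+_ (ℤ.*-zeroˡ (K nothing)) (∑-cong (upTo n) (λ m → ∑-bools-ind m y (λ x → K (just x)))) ⟩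
  + 0 + ∑ (upTo n) (λ m → ⟦ m ≡ᵇ length y ⟧ * K (just y))
    ≡⟨ cong (λ t → + 0 + t) (∑-select (upTo n) (length y) (K (just y)) (Unique.upTo⁺ n) (∈-upTo⁺ y<n)) ⟩
  + 0 + K (just y) ≡⟨ ℤ.+-identityˡ _ ⟩
  K (just y) ∎

-- By linearity the sums move inside `Δ₁`, where `ind²` selects a single pair; by `Δ₁-cong-bounded`
-- this pair is among the summands.
Δ₁-reproduces : ∀ σ a (H : Maybe (List Bool) → Maybe (List Bool) → ℤ) → let L = maybeBools (suc (length a)) in
  ∑ L (λ X → ∑ L (λ Y → Δ₁ σ a (ind² X Y) * H X Y)) ≡ Δ₁ σ a (λ x Y → H (just x) Y)
Δ₁-reproduces σ a H = begin
  ∑ L (λ X → ∑ L (λ Y → Δ₁ σ a (ind² X Y) * H X Y))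
    ≡⟨ ∑-cong L (λ X → ∑-cong L (λ Y → trans (ℤ.*-comm (Δ₁ σ a (ind² X Y)) (H X Y)) (sym (Δ₁-* σ a (H X Y) (ind² X Y))))) ⟩
  ∑ L (λ X → ∑ L (λ Y → Δ₁ σ a (λ x y → H X Y * ind² X Y x y)))
    ≡⟨ ∑-cong L (λ X → sym (Δ₁-∑ σ a L (λ Y x y → H X Y * ind² X Y x y))) ⟩
  ∑ L (λ X → Δ₁ σ a (λ x y → ∑ L (λ Y → H X Y * ind² X Y x y)))
    ≡⟨ Δ₁-∑ σ a L (λ X x y → ∑ L (λ Y → H X Y * ind² X Y x y)) ⟨
  Δ₁ σ a (λ x y → ∑ L (λ X → ∑ L (λ Y → H X Y * ind² X Y x y)))
    ≡⟨ Δ₁-cong-bounded σ a (λ x y p q → select x y (s≤s p) (ℕ.m≤n⇒m≤1+n q)) ⟩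
  Δ₁ σ a (λ x Y → H (just x) Y) ∎
  where
  L : List (Maybe (List Bool))
  L = maybeBools (suc (length a))
  lem : ∀ h a b → h * (a * b) ≡ a * (b * h)
  lem = solve-∀
  select : ∀ x y → ∣ just x ∣ₘ ≤ suc (length a) → ∣ y ∣ₘ ≤ suc (length a) →
    ∑ L (λ X → ∑ L (λ Y → H X Y * ind² X Y x y)) ≡ H (just x) y
  select x y p q = begin
    ∑ L (λ X → ∑ L (λ Y → H X Y * ind² X Y x y))
      ≡⟨ ∑-cong L (λ X → trans (∑-cong L (λ Y → lem (H X Y) (ind? X (just x)) (ind? Y y)))
           (trans (∑-*ˡ L (ind? X (just x)) (λ Y → ind? Y y * H X Y))
             (cong (ind? X (just x) *_) (∑-maybeBools-ind? (suc (length a)) y (H X) q)))) ⟩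
    ∑ L (λ X → ind? X (just x) * H X y) ≡⟨ ∑-maybeBools-ind? (suc (length a)) (just x) (λ X → H X y) p ⟩
    H (just x) y ∎

-- Uniqueness of the antipode

-- Only the constant labelling gives the factor of label `σ` its full length, and it contributes the
-- value at `a` and `nothing`. Exchanging these values between the two sides avoids subtraction.
Δ₁-cong-below : ∀ σ a {F G : List Bool → Maybe (List Bool) → ℤ} → (∀ y X → length y < length a → F y X ≡ G y X) →
  Δ₁ σ a F + G a nothing ≡ Δ₁ σ a G + F a nothing
Δ₁-cong-below σ []      {F} {G} e = ℤ.+-comm (F [] nothing) (G [] nothing)
Δ₁-cong-below σ (c ∷ a) {F} {G} e = begin
  Δ₁ σ a F₁ + k * Δ₁ (not σ) a F₂ + G₁ a nothing ≡⟨ lem (Δ₁ σ a F₁) (k * Δ₁ (not σ) a F₂) (G₁ a nothing) ⟩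
  Δ₁ σ a F₁ + G₁ a nothing + k * Δ₁ (not σ) a F₂
    ≡⟨ cong₂ (λ s t → s + k * t) (Δ₁-cong-below σ a (λ y X p → e (c ∷ y) X (s≤s p)))
         (Δ₁-cong-bounded (not σ) a λ
           { x nothing  p q → e [] (just x) (s≤s z≤n)
           ; x (just y) p q → cong₂ _+_ (cong₂ _+_ (e (false ∷ y) (just x) (s≤s q)) (e (true ∷ y) (just x) (s≤s q)))
                                (e y (just x) (ℕ.≤-trans q (ℕ.n≤1+n _))) }) ⟩
  Δ₁ σ a G₁ + F₁ a nothing + k * Δ₁ (not σ) a G₂ ≡⟨ lem (Δ₁ σ a G₁) (F₁ a nothing) (k * Δ₁ (not σ) a G₂) ⟩
  Δ₁ σ a G₁ + k * Δ₁ (not σ) a G₂ + F₁ a nothing ∎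
  where
  k : ℤ
  k = ⟦ c == σ ⟧
  F₁ G₁ F₂ G₂ : List Bool → Maybe (List Bool) → ℤ
  F₁ x = F (c ∷ x)
  G₁ x = G (c ∷ x)
  F₂ x = •× (λ y → F y (just x))
  G₂ x = •× (λ y → G y (just x))
  lem : ∀ a b c → a + b + c ≡ a + c + b
  lem = solve-∀

module _ (w : Composition → List ℕ) (perm : IsPermChoice w)
         (S : Composition → LC) (antipode : IsAntipode w S) where

  convTerm : (Composition → ℤ) → Maybe (List Bool) → Maybe (List Bool) → ℤ
  convTerm f X Y = pairing (mul (basis (κ′ X)) (S (κ′ Y))) f

  pairing-rightConv : ∀ a f → pairing (rightConv w S (κ a)) f ≡
    Δ₁ false a (λ x Y → convTerm f (just x) Y) + Δ₁ true a (λ y X → convTerm f X (just y))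
  pairing-rightConv a f = begin
    pairing (rightConv w S (κ a)) f
      ≡⟨ ∑-concatMap term (coproduct w (κ a)) _ ⟩
    ∑ (coproduct w (κ a)) (λ t → pairing (term t) f)
      ≡⟨ ∑-cong (coproduct w (κ a)) (λ t → pairing-scale (+ proj₁ t) (mul (basis (proj₁ (proj₂ t))) (S (proj₂ (proj₂ t)))) f) ⟩
    ∑ (coproduct w (κ a)) g
      ≡⟨ ∑-concatMap (λ β → map (λ η → coprodCoeff w (κ a) β η , β , η) (compsUpTo (size (κ a)))) (compsUpTo (size (κ a))) g ⟩
    ∑ (compsUpTo (size (κ a))) (λ β → ∑ (map (λ η → coprodCoeff w (κ a) β η , β , η) (compsUpTo (size (κ a)))) g)
      ≡⟨ ∑-cong (compsUpTo (size (κ a))) (λ β → ∑-map (λ η → coprodCoeff w (κ a) β η , β , η) (compsUpTo (size (κ a))) g) ⟩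
    ∑ (compsUpTo (size (κ a))) (λ β → ∑ (compsUpTo (size (κ a))) (λ η → c β η))
      ≡⟨ cong (λ n → ∑ (compsUpTo n) (λ β → ∑ (compsUpTo n) (λ η → c β η))) (size-κ a) ⟩
    ∑ (compsUpTo n) (λ β → ∑ (compsUpTo n) (λ η → c β η))
      ≡⟨ trans (∑-compsUpTo n (λ β → ∑ (compsUpTo n) (c β))) (∑-cong L (λ X → ∑-compsUpTo n (c (κ′ X)))) ⟩
    ∑ L (λ X → ∑ L (λ Y → c (κ′ X) (κ′ Y)))
      ≡⟨ ∑-cong L (λ X → trans (∑-cong L (λ Y → trans (cong (_* convTerm f X Y) (coprodCoeff-Δ₁ w perm a X Y))
           (ℤ.*-distribʳ-+ (convTerm f X Y) (Δ₁ false a (ind² X Y)) (Δ₁ true a (ind² Y X)))))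
           (∑-+ L (λ Y → Δ₁ false a (ind² X Y) * convTerm f X Y) (λ Y → Δ₁ true a (ind² Y X) * convTerm f X Y))) ⟩
    ∑ L (λ X → ∑ L (λ Y → Δ₁ false a (ind² X Y) * convTerm f X Y) + ∑ L (λ Y → Δ₁ true a (ind² Y X) * convTerm f X Y))
      ≡⟨ ∑-+ L (λ X → ∑ L (λ Y → Δ₁ false a (ind² X Y) * convTerm f X Y)) (λ X → ∑ L (λ Y → Δ₁ true a (ind² Y X) * convTerm f X Y)) ⟩
    ∑ L (λ X → ∑ L (λ Y → Δ₁ false a (ind² X Y) * convTerm f X Y)) + ∑ L (λ X → ∑ L (λ Y → Δ₁ true a (ind² Y X) * convTerm f X Y))
      -- `Δ₁ true` lists the factor labelled B first, which is the second tensor factor; hence the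
      -- interchange of the sums for that term.
      ≡⟨ cong₂ _+_ (Δ₁-reproduces false a (convTerm f))
           (trans (∑-swap L L (λ X Y → Δ₁ true a (ind² Y X) * convTerm f X Y)) (Δ₁-reproduces true a (λ Y X → convTerm f X Y))) ⟩
    Δ₁ false a (λ x Y → convTerm f (just x) Y) + Δ₁ true a (λ y X → convTerm f X (just y)) ∎
    where
    n : ℕ
    n = suc (length a)
    L : List (Maybe (List Bool))
    L = maybeBools n
    term : ℕ × Composition × Composition → LC
    term t = scale (+ proj₁ t) (mul (basis (proj₁ (proj₂ t))) (S (proj₂ (proj₂ t))))
    g : ℕ × Composition × Composition → ℤ
    g t = + proj₁ t * pairing (mul (basis (proj₁ (proj₂ t))) (S (proj₂ (proj₂ t)))) f
    c : Composition → Composition → ℤ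
    c β η = g (coprodCoeff w (κ a) β η , β , η)

  w-∅ : w [] ≡ []
  w-∅ = ↭-empty-inv (proj₁ (perm [] []))

  coprodCoeff-∅ : coprodCoeff w [] [] [] ≡ 1
  coprodCoeff-∅ rewrite w-∅ = refl

  -- At ∅ the coproduct has the single term 1 ⊗ 1, so the antipode equation reads 1 · S(1) = 1.
  pairing-S-∅ : ∀ f → pairing (S []) f ≡ f []
  pairing-S-∅ f = begin
    pairing (S []) f ≡⟨ pairing-cong (S []) _ f (λ η → pairing-basis η f) ⟨
    pairing (S []) (λ η → pairing (mulBasis [] η) f) ≡⟨ pairing-mul-basis [] (S []) f ⟨
    pairing (mul (basis []) (S [])) f ≡⟨ ℤ.*-identityˡ _ ⟨
    + 1 * pairing (mul (basis []) (S [])) f ≡⟨ cong (λ n → + n * pairing (mul (basis []) (S [])) f) coprodCoeff-∅ ⟨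
    + coprodCoeff w [] [] [] * pairing (mul (basis []) (S [])) f
      ≡⟨ pairing-scale (+ coprodCoeff w [] [] []) (mul (basis []) (S [])) f ⟨
    pairing (scale (+ coprodCoeff w [] [] []) (mul (basis []) (S []))) f
      ≡⟨ trans (∑-++ (scale (+ coprodCoeff w [] [] []) (mul (basis []) (S []))) [] _) (ℤ.+-identityʳ _) ⟨
    pairing (rightConv w S []) f ≡⟨ pairing-≈ (rightConv w S []) (basis []) f (proj₂ (proj₂ (antipode [] []))) ⟩
    pairing (basis []) f ≡⟨ pairing-basis [] f ⟩
    f [] ∎

  rightConv-zero : ∀ a f → pairing (rightConv w S (κ a)) f ≡ + 0
  rightConv-zero a f = trans
    (pairing-≈ (rightConv w S (κ a)) (epsUnit (κ a)) f (proj₂ (proj₂ (antipode (κ a) (κ′-valid (just a)))))) no-unit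
    where
    no-unit : pairing (epsUnit (κ a)) f ≡ + 0
    no-unit with _ , _ , e ← bitsToComp-∷ a 1 rewrite e = refl

  -- Induction on a bound for the length, for all `f` at once because left multiplication by R_X
  -- changes the functional. In id ⋆ S, only the term ∅ ⊗ R_a applies S to a ribbon as long as that
  -- of `a`.
  antipode≡S̃ : ∀ n a f → length a < n → pairing (S (κ a)) f ≡ S̃ a (λ z → f (κ z))
  antipode≡S̃ (suc n) a f (s≤s a≤n) = begin
    pairing (S (κ a)) f ≡⟨ convTerm-∅ˡ ⟨
    -- hA + hB = 0 is the antipode equation, and hA + pB = 0 follows from `conv-A` and `conv-B`.
    -- With hB - hₐ = pB - pₐ from `balance` this leaves hₐ = pₐ.
    hₐ ≡⟨ lem hA hB pB hₐ pₐ balance (trans (sym (pairing-rightConv a f)) (rightConv-zero a f))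
            (trans (cong (_+ pB) A-agree) (trans (cong₂ _+_ (conv-A a k) (conv-B a k)) (ℤ.+-inverseʳ (half a k)))) ⟩
    pₐ ∎
    where
    k : List Bool → ℤ
    k z = f (κ z)
    hA hB pB hₐ pₐ : ℤ
    hA = Δ₁ false a (λ x Y → convTerm f (just x) Y)
    hB = Δ₁ true a (λ y X → convTerm f X (just y))
    pB = Δ₁ true a (λ y X → RS̃ k X (just y))
    hₐ = convTerm f nothing (just a)
    pₐ = RS̃ k nothing (just a)
    convTerm-∅ˡ : hₐ ≡ pairing (S (κ a)) f
    convTerm-∅ˡ = trans (pairing-mul-basis [] (S (κ a)) f) (pairing-cong (S (κ a)) _ f (λ η → pairing-basis η f))
    convTerm-RS̃ : ∀ X y → length y < length a → convTerm f X (just y) ≡ RS̃ k X (just y)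
    convTerm-RS̃ X y p = trans (pairing-mul-basis (κ′ X) (S (κ y)) f)
      (trans (antipode≡S̃ n y _ (ℕ.<-≤-trans p a≤n)) (product X))
      where
      product : ∀ X → S̃ y (λ z → pairing (mulBasis (κ′ X) (κ z)) f) ≡ RS̃ k X (just y)
      product nothing  = S̃-cong y (λ z → pairing-basis (κ z) f)
      product (just x) = S̃-cong y (λ z → mulBasis-κ x z f)
    -- Since the first box is labelled A, the second factor is ∅, where S(1) = 1, or has fewer boxes
    -- than R_a, where the induction applies.
    A-agree : hA ≡ Δ₁ false a (λ x Y → RS̃ k (just x) Y)
    A-agree = Δ₁-cong-bounded false a λ
      { x nothing  p q → trans (pairing-mul-basis (κ x) (S []) f) (trans (pairing-S-∅ _) (mulBasis-∅ʳ x f))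
      ; x (just y) p q → convTerm-RS̃ (just x) y q }
    balance : hB + pₐ ≡ pB + hₐ
    balance = Δ₁-cong-below true a (λ y X p → convTerm-RS̃ X y p)
    lem : ∀ hA hB pB h₀ p₀ → hB + p₀ ≡ pB + h₀ → hA + hB ≡ + 0 → hA + pB ≡ + 0 → h₀ ≡ p₀
    lem hA hB pB h₀ p₀ e e₁ e₂ = begin
      h₀                       ≡⟨ i hA pB h₀ ⟩
      (pB + h₀) + hA + - (hA + pB) ≡⟨ cong₂ (λ s t → s + hA + - t) (sym e) (trans e₂ (sym e₁)) ⟩
      (hB + p₀) + hA + - (hA + hB) ≡⟨ i hA hB p₀ ⟨
      p₀                       ∎
      where
      i : ∀ a b h → h ≡ (b + h) + a + - (a + b)
      i = solve-∀

-- From `S̃` to mergings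

-- The value of `k` on the product of the factors c + 1 over the letters c of the word: each letter
-- is kept or deleted.
deletions : List Bool → (List Bool → ℤ) → ℤ
deletions []      k = k []
deletions (c ∷ o) k = deletions o (λ z → k (c ∷ z)) + deletions o k

deletions-∷ʳ : ∀ o c k → deletions (o ∷ʳ c) k ≡ deletions o (λ z → k (z ∷ʳ c)) + deletions o k
deletions-∷ʳ []      c k = refl
deletions-∷ʳ (d ∷ o) c k = trans (cong₂ _+_ (deletions-∷ʳ o c (λ z → k (d ∷ z))) (deletions-∷ʳ o c k))
  (lem (deletions o (λ z → k (d ∷ z ∷ʳ c))) (deletions o (λ z → k (d ∷ z))) (deletions o (λ z → k (z ∷ʳ c))) (deletions o k))
  where
  lem : ∀ a b c d → a + b + (c + d) ≡ a + c + (b + d)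
  lem = solve-∀

-- One sign for each letter and one from S̃ = - φ make up the exponent. The word is reversed because
-- φ reverses products, and complemented because φ replaces each letter by the other one.
S̃-deletions : ∀ a k → S̃ a k ≡ (- (+ 1)) ^ suc (length a) * deletions (reverse (map not a)) k
S̃-deletions []      k = sym (ℤ.-1*i≡-i (k []))
S̃-deletions (c ∷ a) k = begin
  - (S̃ a k′ + S̃ a k) ≡⟨ cong₂ (λ s t → - (s + t)) (S̃-deletions a k′) (S̃-deletions a k) ⟩
  - (ε * deletions o k′ + ε * deletions o k) ≡⟨ lem ε (deletions o k′) (deletions o k) ⟩
  - (+ 1) * ε * (deletions o k′ + deletions o k) ≡⟨ cong (- (+ 1) * ε *_) (deletions-∷ʳ o (not c) k) ⟨
  - (+ 1) * ε * deletions (o ∷ʳ not c) k ≡⟨ cong (λ t → - (+ 1) * ε * deletions t k) (unfold-reverse (not c) (map not a)) ⟨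
  - (+ 1) * ε * deletions (reverse (map not (c ∷ a))) k ∎
  where
  k′ : List Bool → ℤ
  k′ z = k (z ∷ʳ not c)
  ε : ℤ
  ε = (- (+ 1)) ^ suc (length a)
  o : List Bool
  o = reverse (map not a)
  lem : ∀ e a b → - (e * a + e * b) ≡ - (+ 1) * e * (a + b)
  lem = solve-∀

partialSums-positions : ∀ p bs c → partialSumsFrom p (bitsToComp bs c) ≡ positions (p ℕ.+ c) bs
partialSums-positions p []           c = refl
partialSums-positions p (true ∷ bs)  c with k , r , e ← bitsToComp-∷ bs 1 = begin
  partialSumsFrom p (c ∷ κ bs)                       ≡⟨ cong (λ t → partialSumsFrom p (c ∷ t)) e ⟩
  (p ℕ.+ c) ∷ partialSumsFrom (p ℕ.+ c) (k ℕ.+ 1 ∷ r) ≡⟨ cong (λ t → (p ℕ.+ c) ∷ partialSumsFrom (p ℕ.+ c) t) e ⟨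
  (p ℕ.+ c) ∷ partialSumsFrom (p ℕ.+ c) (κ bs)        ≡⟨ cong ((p ℕ.+ c) ∷_) (partialSums-positions (p ℕ.+ c) bs 1) ⟩
  (p ℕ.+ c) ∷ positions (p ℕ.+ c ℕ.+ 1) bs           ≡⟨ cong (λ i → (p ℕ.+ c) ∷ positions i bs) (ℕ.+-comm (p ℕ.+ c) 1) ⟩
  (p ℕ.+ c) ∷ positions (suc (p ℕ.+ c)) bs           ∎
partialSums-positions p (false ∷ bs) c =
  trans (partialSums-positions p bs (suc c)) (cong (λ i → positions i bs) (ℕ.+-suc p c))

κ-replicate-false : ∀ c → κ (replicate c false) ≡ suc c ∷ []
κ-replicate-false c = trans (go c 1) (cong (_∷ []) (ℕ.+-comm c 1))
  where
  go : ∀ c d → bitsToComp (replicate c false) d ≡ c ℕ.+ d ∷ []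
  go zero    d = refl
  go (suc c) d = trans (go c (suc d)) (cong (_∷ []) (ℕ.+-suc c d))

κ-++-true : ∀ x z → κ (x ++ true ∷ z) ≡ κ x ++ κ z
κ-++-true x z = begin
  κ (x ++ true ∷ z)     ≡⟨ bitsToComp-++ x 1 (true ∷ z) ⟩
  i ++ l ∷ κ z          ≡⟨ ++-assoc i (l ∷ []) (κ z) ⟨
  (i ++ l ∷ []) ++ κ z  ≡⟨ cong (_++ κ z) (bitsToComp-++ x 1 []) ⟨
  κ (x ++ []) ++ κ z    ≡⟨ cong (λ t → κ t ++ κ z) (++-identityʳ x) ⟩
  κ x ++ κ z            ∎
  where
  i : List ℕ
  i = proj₁ (lastSplit x 1)
  l : ℕ
  l = proj₂ (lastSplit x 1)

-- The counter `suc c` stands for `c` letters h already read, which come last after the reversal.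
reverse-bitsToComp : ∀ a c → reverse (bitsToComp a (suc c)) ≡ κ (reverse a ++ replicate c false)
reverse-bitsToComp []          c = sym (κ-replicate-false c)
reverse-bitsToComp (true ∷ a)  c = begin
  reverse (suc c ∷ κ a)                       ≡⟨ unfold-reverse (suc c) (κ a) ⟩
  reverse (κ a) ++ suc c ∷ []                 ≡⟨ cong₂ _++_ (reverse-bitsToComp a 0) (sym (κ-replicate-false c)) ⟩
  κ (reverse a ++ []) ++ κ (replicate c false) ≡⟨ cong (λ t → κ t ++ κ (replicate c false)) (++-identityʳ (reverse a)) ⟩
  κ (reverse a) ++ κ (replicate c false)      ≡⟨ κ-++-true (reverse a) (replicate c false) ⟨
  κ (reverse a ++ true ∷ replicate c false)   ≡⟨ cong κ (++-assoc (reverse a) (true ∷ []) (replicate c false)) ⟨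
  κ (reverse a ∷ʳ true ++ replicate c false)  ≡⟨ cong (λ t → κ (t ++ replicate c false)) (unfold-reverse true a) ⟨
  κ (reverse (true ∷ a) ++ replicate c false) ∎
reverse-bitsToComp (false ∷ a) c = begin
  reverse (bitsToComp a (suc (suc c)))     ≡⟨ reverse-bitsToComp a (suc c) ⟩
  κ (reverse a ++ false ∷ replicate c false) ≡⟨ cong κ (++-assoc (reverse a) (false ∷ []) (replicate c false)) ⟨
  κ (reverse a ∷ʳ false ++ replicate c false) ≡⟨ cong (λ t → κ (t ++ replicate c false)) (unfold-reverse false a) ⟨
  κ (reverse (false ∷ a) ++ replicate c false) ∎

reverse-κ : ∀ a → reverse (κ a) ≡ κ (reverse a)
reverse-κ a = trans (reverse-bitsToComp a 0) (cong κ (++-identityʳ (reverse a)))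

interval : ℕ → ℕ → List ℕ
interval j zero    = []
interval j (suc n) = j ∷ interval (suc j) n

applyUpTo-interval : ∀ f j n → (∀ i → f i ≡ i ℕ.+ j) → applyUpTo f n ≡ interval j n
applyUpTo-interval f j zero    e = refl
applyUpTo-interval f j (suc n) e = cong₂ _∷_ (e 0)
  (applyUpTo-interval (f ∘ suc) (suc j) n (λ i → trans (e (suc i)) (sym (ℕ.+-suc i j))))

elem-positions-< : ∀ j i r → j < i → elem j (positions i r) ≡ false
elem-positions-< j i []          j<i = refl
elem-positions-< j i (true ∷ r)  j<i rewrite ≡ᵇ-false j i (ℕ.<⇒≢ j<i) = elem-positions-< j (suc i) r (ℕ.m≤n⇒m≤1+n j<i)
elem-positions-< j i (false ∷ r) j<i = elem-positions-< j (suc i) r (ℕ.m≤n⇒m≤1+n j<i)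

-- The predicate is compared only from `j` onwards, so that the induction can drop `j` from the set
-- of positions.
filter-complement : ∀ (p : ℕ → Bool) j r → (∀ i → j ≤ i → p i ≡ elem i (positions j r)) →
  filter (λ i → T? (not (p i))) (interval j (length r)) ≡ positions j (map not r)
filter-complement p j []          e = refl
filter-complement p j (true ∷ r)  e
  rewrite trans (e j ℕ.≤-refl) (cong (_∨ elem j (positions (suc j) r)) (≡ᵇ-refl j)) =
  filter-complement p (suc j) r (λ i j<i → trans (e i (ℕ.<⇒≤ j<i))
    (cong (_∨ elem i (positions (suc j) r)) (≡ᵇ-false i j (ℕ.<⇒≢ j<i ∘ sym))))
filter-complement p j (false ∷ r) e
  rewrite trans (e j ℕ.≤-refl) (elem-positions-< j (suc j) r ℕ.≤-refl) =
  cong (j ∷_) (filter-complement p (suc j) r (λ i j<i → e i (ℕ.<⇒≤ j<i)))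

-- Reversing a composition reverses its word, and complementing the descent set exchanges h and v.
omega-κ : ∀ a → omega (κ a) ≡ κ (reverse (map not a))
omega-κ a = begin
  omega (κ a)
    ≡⟨ cong₂ (λ n D → compOfSet n (filter (λ i → T? (not (elem i D))) (map suc (upTo (n ∸ 1))))) (size-κ a)
         (trans (cong descentSet (reverse-κ a)) (partialSums-positions 0 r 1)) ⟩
  compOfSet (suc (length a)) (filter (λ i → T? (not (elem i (positions 1 r)))) (map suc (upTo (length a))))
    ≡⟨ cong₂ (λ m L → compOfSet (suc m) (filter (λ i → T? (not (elem i (positions 1 r)))) L))
         (sym length-o)
         (trans (map-upTo suc (length a)) (trans (applyUpTo-interval suc 1 (length a) (λ i → ℕ.+-comm 1 i))
           (cong (interval 1) (sym (length-reverse a))))) ⟩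
  compOfSet (suc (length (map not r))) (filter (λ i → T? (not (elem i (positions 1 r)))) (interval 1 (length r)))
    ≡⟨ cong (compOfSet (suc (length (map not r)))) (filter-complement (λ i → elem i (positions 1 r)) 1 r (λ _ _ → refl)) ⟩
  compOfSet (suc (length (map not r))) (positions 1 (map not r)) ≡⟨ diffs-positions 0 1 (map not r) ⟩
  κ (map not r)             ≡⟨ cong κ (reverse-map not a) ⟩
  κ (reverse (map not a))   ∎
  where
  r : List Bool
  r = reverse a
  length-o : length (map not r) ≡ length a
  length-o = trans (length-map not r) (length-reverse a)

hv : Bool → HV
hv false = h
hv true  = v

eqHVs-hv : ∀ x y → ⟦ eqHVs (map hv x) (map hv y) ⟧ ≡ ind x y
eqHVs-hv []      []      = refl
eqHVs-hv []      (_ ∷ _) = refl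
eqHVs-hv (_ ∷ _) []      = refl
eqHVs-hv (true ∷ x)  (true ∷ y)  = trans (eqHVs-hv x y) (sym (ℤ.*-identityˡ (ind x y)))
eqHVs-hv (true ∷ x)  (false ∷ y) = sym (ℤ.*-zeroˡ (ind x y))
eqHVs-hv (false ∷ x) (true ∷ y)  = sym (ℤ.*-zeroˡ (ind x y))
eqHVs-hv (false ∷ x) (false ∷ y) = trans (eqHVs-hv x y) (sym (ℤ.*-identityˡ (ind x y)))

ribbonWord-bitsToComp : ∀ o c → ribbonWord (bitsToComp o (suc c)) ≡ replicate c h ++ map hv o
ribbonWord-bitsToComp []          c = sym (++-identityʳ (replicate c h))
ribbonWord-bitsToComp (true ∷ o)  c with k , r , e ← bitsToComp-∷ o 1 = begin
  ribbonWord (suc c ∷ κ o)                       ≡⟨ cong (λ t → ribbonWord (suc c ∷ t)) e ⟩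
  replicate c h ++ v ∷ ribbonWord (k ℕ.+ 1 ∷ r)  ≡⟨ cong (λ t → replicate c h ++ v ∷ ribbonWord t) e ⟨
  replicate c h ++ v ∷ ribbonWord (κ o)          ≡⟨ cong (λ t → replicate c h ++ v ∷ t) (ribbonWord-bitsToComp o 0) ⟩
  replicate c h ++ v ∷ map hv o                  ∎
ribbonWord-bitsToComp (false ∷ o) c = trans (ribbonWord-bitsToComp o (suc c)) (move c)
  where
  move : ∀ c → replicate (suc c) h ++ map hv o ≡ replicate c h ++ h ∷ map hv o
  move zero    = refl
  move (suc c) = cong (h ∷_) (move c)

-- The marks `false` and `true` on a letter, keeping and deleting it, correspond to the two summands
-- of `deletions`.
∑-deleteMarked : ∀ o (K : List HV → ℤ) →
  ∑ (bools (length o)) (λ X → K (deleteMarked X (map hv o))) ≡ deletions o (λ z → K (map hv z))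
∑-deleteMarked []      K = ℤ.+-identityʳ (K [])
∑-deleteMarked (c ∷ o) K = trans (∑-bools (length o) (λ X → K (deleteMarked X (map hv (c ∷ o)))))
  (cong₂ _+_ (∑-deleteMarked o (λ t → K (hv c ∷ t))) (∑-deleteMarked o K))

mergings-κ : ∀ o b → + mergings (κ o) (κ b) ≡ deletions o (λ z → ind z b)
mergings-κ o b = begin
  + mergings (κ o) (κ b)
    ≡⟨ cong +_ unfolded ⟩
  + count (λ X → eqHVs (deleteMarked X (ribbonWord (κ o))) (ribbonWord (κ b))) (bools (size (κ o) ∸ 1))
    ≡⟨ ∑-count (λ X → eqHVs (deleteMarked X (ribbonWord (κ o))) (ribbonWord (κ b))) (bools (size (κ o) ∸ 1)) ⟩
  ∑ (bools (size (κ o) ∸ 1)) (λ X → ⟦ eqHVs (deleteMarked X (ribbonWord (κ o))) (ribbonWord (κ b)) ⟧)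
    ≡⟨ cong (λ n → ∑ (bools (n ∸ 1)) (λ X → ⟦ eqHVs (deleteMarked X (ribbonWord (κ o))) (ribbonWord (κ b)) ⟧)) (size-κ o) ⟩
  ∑ (bools (length o)) (λ X → ⟦ eqHVs (deleteMarked X (ribbonWord (κ o))) (ribbonWord (κ b)) ⟧)
    ≡⟨ cong₂ (λ s t → ∑ (bools (length o)) (λ X → ⟦ eqHVs (deleteMarked X s) t ⟧))
         (ribbonWord-bitsToComp o 0) (ribbonWord-bitsToComp b 0) ⟩
  ∑ (bools (length o)) (λ X → ⟦ eqHVs (deleteMarked X (map hv o)) (map hv b) ⟧)
    ≡⟨ ∑-deleteMarked o (λ s → ⟦ eqHVs s (map hv b) ⟧) ⟩
  deletions o (λ z → ⟦ eqHVs (map hv z) (map hv b) ⟧) ≡⟨ deletions-cong o (λ z → eqHVs-hv z b) ⟩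
  deletions o (λ z → ind z b) ∎
  where
  unfolded : mergings (κ o) (κ b) ≡
    count (λ X → eqHVs (deleteMarked X (ribbonWord (κ o))) (ribbonWord (κ b))) (bools (size (κ o) ∸ 1))
  unfolded with _ , _ , e ← bitsToComp-∷ o 1 | _ , _ , e′ ← bitsToComp-∷ b 1 rewrite e | e′ = refl
  deletions-cong : ∀ o {k l} → (∀ z → k z ≡ l z) → deletions o k ≡ deletions o l
  deletions-cong []      e = e []
  deletions-cong (c ∷ o) e = cong₂ _+_ (deletions-cong o (λ z → e (c ∷ z))) (deletions-cong o e)

mergings-∅ʳ : ∀ α → mergings α [] ≡ 0
mergings-∅ʳ []      = refl
mergings-∅ʳ (_ ∷ _) = refl

S̃-0 : ∀ a → S̃ a (λ _ → + 0) ≡ + 0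
S̃-0 []      = refl
S̃-0 (c ∷ a) rewrite S̃-0 a = refl

theorem4p6 : (w : Composition → List ℕ) → IsPermChoice w →
    (S : Composition → LC) → IsAntipode w S →
    (α : Composition) → IsComposition α → 1 ≤ size α →
    (β : Composition) → IsComposition β →
    coeff (S α) β ≡ ((- (+ 1)) ^ size α) * (+ mergings (omega α) β)
theorem4p6 w perm S antipode (x ∷ α) (0<x ∷ α-valid) _ β β-valid
  with a , κa≡α ← κ-surjective x α 0<x α-valid =
  subst (λ α → coeff (S α) β ≡ ((- (+ 1)) ^ size α) * (+ mergings (omega α) β)) κa≡α (begin
    coeff (S (κ a)) β          ≡⟨ coeff-pairing (S (κ a)) β ⟩
    pairing (S (κ a)) (δ β)    ≡⟨ antipode≡S̃ w perm S antipode (suc (length a)) a (δ β) ℕ.≤-refl ⟩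
    S̃ a (λ z → δ β (κ z))      ≡⟨ evaluate β β-valid ⟩
    sign (suc (length a)) * + mergings (κ (reverse (map not a))) β
      ≡⟨ cong₂ (λ n o → sign n * + mergings o β) (size-κ a) (omega-κ a) ⟨
    sign (size (κ a)) * + mergings (omega (κ a)) β ∎)
  where
  sign : ℕ → ℤ
  sign n = (- (+ 1)) ^ n
  evaluate : ∀ β → IsComposition β →
    S̃ a (λ z → δ β (κ z)) ≡ sign (suc (length a)) * + mergings (κ (reverse (map not a))) β
  -- For ∅ both sides are 0: no word encodes ∅, and `mergings` has the value 0 there.
  evaluate [] _ = begin
    S̃ a (λ z → δ [] (κ z)) ≡⟨ S̃-cong a κ≢∅ ⟩
    S̃ a (λ _ → + 0)        ≡⟨ S̃-0 a ⟩
    + 0                    ≡⟨ ℤ.*-zeroʳ (sign (suc (length a))) ⟨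
    sign (suc (length a)) * + 0 ≡⟨ cong (λ n → sign (suc (length a)) * + n) (mergings-∅ʳ (κ (reverse (map not a)))) ⟨
    sign (suc (length a)) * + mergings (κ (reverse (map not a))) [] ∎
    where
    κ≢∅ : ∀ z → δ [] (κ z) ≡ + 0
    κ≢∅ z with _ , _ , e ← bitsToComp-∷ z 1 rewrite e = refl
  evaluate (y ∷ β) (0<y ∷ valid) with b , e ← κ-surjective y β 0<y valid =
    subst (λ β → S̃ a (λ z → δ β (κ z)) ≡ sign (suc (length a)) * + mergings (κ (reverse (map not a))) β) e (begin
      S̃ a (λ z → δ (κ b) (κ z)) ≡⟨ S̃-cong a (λ z → eqℕs-bitsToComp z b 1) ⟩
      S̃ a (λ z → ind z b) ≡⟨ S̃-deletions a (λ z → ind z b) ⟩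
      sign (suc (length a)) * deletions (reverse (map not a)) (λ z → ind z b)
        ≡⟨ cong (sign (suc (length a)) *_) (mergings-κ (reverse (map not a)) b) ⟨
      sign (suc (length a)) * + mergings (κ (reverse (map not a))) (κ b) ∎)
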